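{- Let $T_0$ be any initial BST. For every $\epsilon>0$ there exist a query sequence $X$ and a (not necessarily consecutive) subsequence $X'$ of $X$ such that $$\mathrm{cost}(GF,X',T_0)\ge(2-\epsilon)\cdot\mathrm{cost}(GF,X,T_0).$$
   Context: Binary search tree model. Keys are $\{1,\dots,n\}$. A query sequence is $X=[x_1,\dots,x_m]\in[n]^m$ and $T_0$ is an initial binary search tree (BST) on the keys. An algorithm $A$ serves $x_1,\dots,x_m$ in order. Before serving $x_t$ it holds a BST $T_{t-1}$; it searches $x_t$ from the root and may then restructure the tree by rotations into $T_t$. Let $P_t$ be the set of nodes on the root-to-$x_t$ path of $T_{t-1}$, and let $U_t$ be the node set of the minimal subtree containing all edges rotated in transforming $T_{t-1}$ into $T_t$. The cost at time $t$ is $|P_t\cup U_t|$, and $\mathrm{cost}(A,X,T_0)$ is the sum of these costs over $t=1,\dots,m$. Greedy Future ($GF$). After finding $x_t$ in $T_{t-1}$, let $v_1<\dots<v_k$ be the keys on the root-to-$x_t$ path, set $v_0=-\infty$ and $v_{k+1}=+\infty$, and let $R_0,\dots,R_k$ be the subtrees hanging off this path. For each $i$, $\tau(v_i)$ is the smallest $s>t$ with $x_s\in(v_{i-1},v_{i+1})$, or $+\infty$ if there is none. $GF$ rearranges $v_1,\dots,v_k$ as a treap: a BST in key order and a heap in $\tau$, with the smallest $\tau$ at the top. Ties in $\tau$ are broken in favor of the node of smaller depth in $T_{t-1}$. It then reattaches $R_0,\dots,R_k$ unchanged at their unique positions, giving $T_t$.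
   Formalization: The query sequence X is required to be nonempty, and T₀ is any initial BST on n keys with n at least a bound depending on ε: for n = 1 every access costs 1, so no nonempty X can reach a ratio above 1. -}

module Defs where

open import Data.Fin using (Fin; _<_)
open import Data.Fin.Properties using (<-cmp; _<?_)
open import Data.Fin.Subset using (Subset; ⊥; ⁅_⁆; _∪_; _∩_; _∈_; _⊆_; ∣_∣; Nonempty)
open import Data.Fin.Subset.Properties using (_⊆?_; nonempty?)
open import Data.List using (List; []; _∷_; _++_; head; length; map; takeWhile)
open import Data.Maybe using (Maybe; just; nothing)
open import Data.Maybe.Relation.Unary.All as Maybe using (All)
open import Data.Nat as ℕ using (ℕ; suc; _+_)
import Data.Nat.Properties as ℕ
open import Data.Product using (_×_; _,_; proj₁)
open import Data.Product.Relation.Binary.Lex.Strict using (×-Lex; ×-decidable)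
open import Data.Tree.Binary using (Tree; leaf; node)
import Data.Tree.Binary.Relation.Unary.All as Tree
open import Data.Unit using (tt) renaming (⊤ to Unit)
open import Relation.Binary using (Decidable; tri<; tri≈; tri>)
open import Relation.Binary.PropositionalEquality using (_≡_)
open import Relation.Nullary using (Dec; yes; no; _×-dec_; ¬?)

private
  variable
    n : ℕ

-- The ordered key set {1,…,n} is Fin n.
KeyTree : ℕ → Set
KeyTree n = Tree (Fin n) Unit

keys : KeyTree n → Subset n
keys (leaf _)     = ⊥
keys (node l k r) = ⁅ k ⁆ ∪ keys l ∪ keys r

AllKeys : (Fin n → Set) → KeyTree n → Set
AllKeys P = Tree.All P (λ _ → Unit)

data SearchTree {n : ℕ} : KeyTree n → Set where
  leaf : SearchTree (leaf tt)
  node : ∀ {l k r} → AllKeys (_< k) l → AllKeys (k <_) r →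
         SearchTree l → SearchTree r → SearchTree (node l k r)

record IsBST {n : ℕ} (T : KeyTree n) : Set where
  field
    searchTree : SearchTree T
    complete   : ∀ k → k ∈ keys T

-- The nodes met when searching x from the root, x included.
path : Fin n → KeyTree n → Subset n
path x (leaf _) = ⊥
path x (node l k r) with <-cmp x k
... | tri< _ _ _ = ⁅ k ⁆ ∪ path x l
... | tri≈ _ _ _ = ⁅ k ⁆
... | tri> _ _ _ = ⁅ k ⁆ ∪ path x r

rotateʳ rotateˡ : KeyTree n → KeyTree n
rotateʳ (node (node a y b) x c) = node a y (node b x c)
rotateʳ T                       = T
rotateˡ (node a x (node b y c)) = node (node a x b) y c
rotateˡ T                       = T

-- Rotates k up to the root, one edge at a time.  Each rotated edge joins k to
-- an ancestor of k; the first component collects the endpoints of these edges.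
raise : Fin n → KeyTree n → Subset n × KeyTree n
raise k (leaf _) = ⊥ , leaf tt
raise k (node l x r) with <-cmp k x
... | tri< _ _ _ = let (E , l′) = raise k l in ⁅ k ⁆ ∪ ⁅ x ⁆ ∪ E , rotateʳ (node l′ x r)
... | tri≈ _ _ _ = ⊥ , node l x r
... | tri> _ _ _ = let (E , r′) = raise k r in ⁅ k ⁆ ∪ ⁅ x ⁆ ∪ E , rotateˡ (node l x r′)

-- Endpoints of the edges rotated in transforming T into T′: the root of T′ is
-- raised to the root of T, then both subtrees are treated in the same way.
-- Every node collected has different sets of keys below it in T and in T′.  As
-- a rotation changes these sets only at the endpoints of its edge, each of these
-- nodes is an endpoint in every sequence of rotations from T to T′.
rotatedEnds : KeyTree n → KeyTree n → Subset n
rotatedEnds T (leaf _) = ⊥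
rotatedEnds T (node l′ k r′) with raise k T
... | E , leaf _     = E
... | E , node l _ r = E ∪ rotatedEnds l l′ ∪ rotatedEnds r r′

-- Nodes of T having a member of S in their subtree.
upwardClosure : Subset n → KeyTree n → Subset n
upwardClosure S (leaf _) = ⊥
upwardClosure S (node l k r) with nonempty? (S ∩ keys (node l k r))
... | yes _ = ⁅ k ⁆ ∪ upwardClosure S l ∪ upwardClosure S r
... | no _  = ⊥

-- The smallest connected set of nodes of T containing S: descend to the lowest
-- common ancestor of S, and take all paths from there to members of S.
spannedSubtree : Subset n → KeyTree n → Subset n
spannedSubtree S (leaf _) = ⊥
spannedSubtree S (node l k r) with S ⊆? keys l | S ⊆? keys r
... | yes _ | _     = spannedSubtree S l
... | no _  | yes _ = spannedSubtree S r
... | no _  | no _  = upwardClosure S (node l k r)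

stepCost : KeyTree n → Fin n → KeyTree n → ℕ
stepCost T x T′ = ∣ path x T ∪ spannedSubtree (rotatedEnds T T′) T ∣

-- The next tree, given the current tree, the query and the future queries.
Algorithm : ℕ → Set
Algorithm n = KeyTree n → Fin n → List (Fin n) → KeyTree n

cost : Algorithm n → List (Fin n) → KeyTree n → ℕ
cost A []       T = 0
cost A (x ∷ xs) T = let T′ = A T x xs in stepCost T x T′ + cost A xs T′

-- R₀ and, in key order, each path key vᵢ with its depth and the subtree Rᵢ
-- hanging immediately to its right; d is the depth of the root.
decompose : Fin n → ℕ → KeyTree n → KeyTree n × List (Fin n × ℕ × KeyTree n)
decompose x d (leaf _) = leaf tt , []
decompose x d (node l k r) with <-cmp x k
... | tri< _ _ _ = let (R₀ , vs) = decompose x (suc d) l in R₀ , vs ++ (k , d , r) ∷ []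
... | tri≈ _ _ _ = l , (k , d , r) ∷ []
... | tri> _ _ _ = let (R₀ , vs) = decompose x (suc d) r in l , (k , d , R₀) ∷ vs

-- Open intervals of keys, with nothing standing for −∞ on the left and +∞ on
-- the right.
Between : Maybe (Fin n) → Maybe (Fin n) → Fin n → Set
Between lo hi y = All (_< y) lo × All (y <_) hi

between? : (lo hi : Maybe (Fin n)) (y : Fin n) → Dec (Between lo hi y)
between? lo hi y = Maybe.dec (_<? y) lo ×-dec Maybe.dec (y <?_) hi

-- Number of future queries before the first one in the interval.  If there is
-- none, this is the number of all future queries, which exceeds every other
-- value and so plays the role of +∞.
nextAccess : Maybe (Fin n) → Maybe (Fin n) → List (Fin n) → ℕ
nextAccess lo hi future = length (takeWhile (λ y → ¬? (between? lo hi y)) future)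

-- τ and the depth in the old tree.
Priority : Set
Priority = ℕ × ℕ

_≺_ : Priority → Priority → Set
_≺_ = ×-Lex _≡_ ℕ._<_ ℕ._<_

_≺?_ : Decidable _≺_
_≺?_ = ×-decidable ℕ._≟_ ℕ._<?_ ℕ._<?_

prioritise : List (Fin n) → Maybe (Fin n) → List (Fin n × ℕ × KeyTree n) →
             List (Fin n × Priority × KeyTree n)
prioritise future lo []                 = []
prioritise future lo ((v , d , R) ∷ vs) =
  (v , (nextAccess lo (head (map proj₁ vs)) future , d) , R) ∷ prioritise future (just v) vs

-- A treap on the path keys; its leaves are the hanging subtrees.
Treap : ℕ → Set
Treap n = Tree (Fin n × Priority) (KeyTree n)

-- Inserts a key below all keys present, with hanging subtree R on its left,
-- in place of the leftmost leaf S, which becomes the subtree on its right.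
insertMin : KeyTree n → Fin n → Priority → Treap n → Treap n
insertMin R v p (leaf S) = node (leaf R) (v , p) (leaf S)
insertMin R v p (node a (w , q) b) with p ≺? q
... | yes _ = node (leaf R) (v , p) (node a (w , q) b)
... | no _  = node (insertMin R v p a) (w , q) b

treap : KeyTree n → List (Fin n × Priority × KeyTree n) → Treap n
treap R₀ []                  = leaf R₀
treap R₀ ((v , p , R₁) ∷ vs) = insertMin R₀ v p (treap R₁ vs)

reattach : Treap n → KeyTree n
reattach (leaf R)           = R
reattach (node a (v , _) b) = node (reattach a) v (reattach b)

GF : Algorithm n
GF T x future = let (R₀ , vs) = decompose x 0 T in reattach (treap R₀ (prioritise future nothing vs))

{-# OPTIONS --safe #-}
module Submission where

-- There are a periodic query sequence and two search trees on the same keys, a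
-- shallow one and a deep one, such that Greedy Future changes neither tree while
-- serving the sequence.  Both are defined by recursion on the height.  With five
-- consecutive groups of keys L < d < r < e < R, where d, r and e are single keys,
-- the queries run cyclically through r, the next query of L, the next query of R,
-- while d and e are never queried.  The shallow tree has root r and hides d and e
-- at the bottom; the deep tree has root d, whose right child e has r and R below
-- it.  Over one period the sums of the path lengths are 3·3ʰ − 2·2ʰ and 6·3ʰ − 5·2ʰ
-- respectively.
--
-- Any search tree can be turned into any other one by queries: returning to the
-- root after every other query brings the root up and keeps it there, so that
-- both subtrees can be treated recursively at the same time.  Hence X first
-- produces the deep tree, then the shallow one, and then repeats the periodic
-- sequence until the initial costs are negligible; X′ omits the second part.
open import Data.Empty using (⊥-elim)
open import Data.Integer using (+_; +[1+_])
import Data.Integer as ℤ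
import Data.Integer.Properties as ℤ
import Data.Integer.Tactic.RingSolver as ℤ-Solver
open import Data.List using (List; []; _∷_; _++_; head; length; filter; replicate; takeWhile)
open import Data.List.Properties
  using (++-assoc; ++-identityʳ; ∷-injective; filter-accept; filter-all; filter-none; filter-reject; filter-++; length-++; length-replicate)
open import Data.List.Membership.Propositional using (_∈_)
open import Data.List.Membership.Propositional.Properties using (∈-++⁻; ∈-++⁺ʳ)
open import Data.List.Relation.Binary.Sublist.Propositional using (_⊆_; ⊆-refl)
open import Data.List.Relation.Binary.Sublist.Propositional.Properties using (++⁺; ++⁺ˡ)
open import Data.List.Relation.Unary.All as All using (All; []; _∷_)
import Data.List.Relation.Unary.All.Properties as All
open import Data.List.Relation.Unary.Any using (here; there)
open import Data.List.Relation.Unary.Linked using (Linked; []; [-]; _∷_)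
open import Data.Fin using (Fin; _<_)
open import Data.Fin.Properties using (<-asym; <-cmp; <-irrefl; <-trans)
open import Data.Fin.Subset using (Subset; ⊤; ⊥; ⁅_⁆; _∪_; ∣_∣; inside; outside) renaming (_∈_ to _∈ˢ_; _∉_ to _∉ˢ_)
open import Data.Fin.Subset.Properties
  using (_⊆?_; ⊥⊆; ∉⊥; ∣⊥∣≡0; ∣⊤∣≡n; ∣⁅x⁆∣≡1; ∣p∣≤n; p⊆q⇒∣p∣≤∣q∣; p⊂q⇒∣p∣<∣q∣; x∈⁅x⁆; x∈⁅y⁆⇒x≡y; x∈p∪q⁻; p⊆p∪q; q⊆p∪q;
         ∪-identityˡ; ∪-identityʳ)
open import Data.Maybe using (Maybe; just; nothing)
import Data.Maybe.Relation.Unary.All as Maybe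
open import Data.Nat as ℕ using (ℕ; zero; suc; _≤_; z≤n; s≤s; _+_; _^_) renaming (_*_ to _·_)
import Data.Nat.Properties as ℕ
open import Data.Nat.Tactic.RingSolver using (solve-∀)
open import Data.Product using (∃-syntax; Σ-syntax; _×_; _,_; proj₁; proj₂)
open import Data.Rational using (ℚ; 0ℚ; _/_; _-_; _*_; _≥_; _>_; mkℚ; toℚᵘ)
import Data.Rational as ℚ
import Data.Rational.Properties as ℚ
open import Data.Rational.Unnormalised as ℚᵘ using (mkℚᵘ; *≤*)
import Data.Rational.Unnormalised.Properties as ℚᵘ
open import Data.Sum using (_⊎_; inj₁; inj₂)
open import Data.Tree.Binary using (leaf; node)
import Data.Tree.Binary.Relation.Unary.All as Tree
open import Data.Unit using (tt) renaming (⊤ to Unit)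
open import Data.Vec using ([]; _∷_)
open import Function using (_∘_; case_of_)
open import Relation.Binary using (tri<; tri≈; tri>)
open import Relation.Binary.PropositionalEquality
  using (_≡_; _≢_; refl; sym; trans; cong; cong₂; subst; subst₂; module ≡-Reasoning)
open import Relation.Nullary using (¬_; yes; no; ¬?)
open import Relation.Unary using (Decidable)
open import Defs

private
  variable
    n d h : ℕ
    lo hi lo′ hi′ : Maybe (Fin n)
    v x y : Fin n
    T T′ l l′ r r′ : KeyTree n
    Q Y F xs ys : List (Fin n)

-- Intervals of keys

_⊑_ : Maybe (Fin n) × Maybe (Fin n) → Maybe (Fin n) × Maybe (Fin n) → Set
(lo′ , hi′) ⊑ (lo , hi) = ∀ {y} → Between lo′ hi′ y → Between lo hi y

⊑-refl : (lo , hi) ⊑ (lo , hi)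
⊑-refl b = b

above-⊑ : Between lo hi v → (just v , hi) ⊑ (lo , hi)
above-⊑ (lo<v , _) (Maybe.just v<y , y<hi) = Maybe.map (λ u<v → <-trans u<v v<y) lo<v , y<hi

below-⊑ : Between lo hi v → (lo , just v) ⊑ (lo , hi)
below-⊑ (_ , v<hi) (lo<y , Maybe.just y<v) = lo<y , Maybe.map (λ v<u → <-trans y<v v<u) v<hi

v∉below : ¬ Between lo (just v) v
v∉below (_ , Maybe.just v<v) = <-irrefl refl v<v

v∉above : ¬ Between (just v) hi v
v∉above (Maybe.just v<v , _) = <-irrefl refl v<v

y<v⇒y∉above : y < v → ¬ Between (just v) hi y
y<v⇒y∉above y<v (Maybe.just v<y , _) = <-asym y<v v<y

v<y⇒y∉below : v < y → ¬ Between lo (just v) y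
v<y⇒y∉below v<y (_ , Maybe.just y<v) = <-asym y<v v<y

below< : Between lo (just v) y → y < v
below< (_ , Maybe.just y<v) = y<v

above> : Between (just v) hi y → v < y
above> (Maybe.just v<y , _) = v<y

toBelow : Between lo hi y → y < v → Between lo (just v) y
toBelow (lo<y , _) y<v = lo<y , Maybe.just y<v

toAbove : Between lo hi y → v < y → Between (just v) hi y
toAbove (_ , y<hi) v<y = Maybe.just v<y , y<hi

-- The lower bound moves along the list, so that splitting the inorder list of a search tree at its
-- root yields exactly the intervals of the two subtrees.
Ascending : Maybe (Fin n) → Maybe (Fin n) → List (Fin n) → Set
Ascending lo hi []       = Unit
Ascending lo hi (x ∷ xs) = Between lo hi x × Ascending (just x) hi xs

ascending-split : ∀ lo xs {v : Fin n} {ys} → Ascending lo hi (xs ++ v ∷ ys) →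
                  Ascending lo (just v) xs × Between lo hi v × Ascending (just v) hi ys
ascending-split lo []       (b , a) = tt , b , a
ascending-split lo (x ∷ xs) (b , a) with ascending-split (just x) xs a
... | a₁ , c , a₂ = (toBelow b (above> c) , a₁) , above-⊑ b c , a₂

ascending-join : ∀ lo xs {v : Fin n} {ys} → Ascending lo (just v) xs → Between lo hi v →
                 Ascending (just v) hi ys → Ascending lo hi (xs ++ v ∷ ys)
ascending-join lo []       a₁       b a₂ = b , a₂
ascending-join lo (x ∷ xs) (c , a₁) b a₂ =
  below-⊑ b c , ascending-join (just x) xs a₁ (toAbove b (below< c)) a₂

ascending⇒between : ∀ lo xs → Ascending {n} lo hi xs → All (Between lo hi) xs
ascending⇒between lo []       a       = []
ascending⇒between lo (x ∷ xs) (b , a) = b ∷ All.map (above-⊑ b) (ascending⇒between (just x) xs a)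

-- Restricted query sequences and next accesses

restrict : Maybe (Fin n) → Maybe (Fin n) → List (Fin n) → List (Fin n)
restrict lo hi = filter (between? lo hi)

filter-⊆ : ∀ {A : Set} {P Q : A → Set} (P? : Decidable P) (Q? : Decidable Q) → (∀ {x} → P x → Q x) →
           ∀ xs → filter P? (filter Q? xs) ≡ filter P? xs
filter-⊆ P? Q? P⊆Q []       = refl
filter-⊆ P? Q? P⊆Q (x ∷ xs) with Q? x
... | no ¬q = trans (filter-⊆ P? Q? P⊆Q xs) (sym (filter-reject P? (¬q ∘ P⊆Q)))
... | yes q with P? x
...   | yes p = cong (x ∷_) (filter-⊆ P? Q? P⊆Q xs)
...   | no ¬p = filter-⊆ P? Q? P⊆Q xs

restrict-⊑ : (lo′ , hi′) ⊑ (lo , hi) → ∀ (xs : List (Fin n)) →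
             restrict lo′ hi′ (restrict lo hi xs) ≡ restrict lo′ hi′ xs
restrict-⊑ sub = filter-⊆ (between? _ _) (between? _ _) sub

takeWhile-accept : ∀ {A : Set} {P : A → Set} (P? : Decidable P) {x xs} → P x →
                   takeWhile P? (x ∷ xs) ≡ x ∷ takeWhile P? xs
takeWhile-accept P? {x} p with P? x
... | yes _ = refl
... | no ¬p = ⊥-elim (¬p p)

takeWhile-reject : ∀ {A : Set} {P : A → Set} (P? : Decidable P) {x xs} → ¬ P x →
                   takeWhile P? (x ∷ xs) ≡ []
takeWhile-reject P? {x} ¬p with P? x
... | yes p = ⊥-elim (¬p p)
... | no _  = refl

nextAccess-here : ∀ {Y} → Between lo hi y → nextAccess {n} lo hi (y ∷ Y) ≡ 0
nextAccess-here b = cong length (takeWhile-reject (λ y → ¬? (between? _ _ y)) (λ ¬b → ¬b b))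

nextAccess-there : ∀ {Y} → ¬ Between lo hi y → nextAccess {n} lo hi (y ∷ Y) ≡ suc (nextAccess lo hi Y)
nextAccess-there ¬b = cong length (takeWhile-accept (λ y → ¬? (between? _ _ y)) ¬b)

nextAccess-antitone : (lo′ , hi′) ⊑ (lo , hi) → ∀ (Y : List (Fin n)) → nextAccess lo hi Y ≤ nextAccess lo′ hi′ Y
nextAccess-antitone sub [] = z≤n
nextAccess-antitone {lo′ = lo′} {hi′ = hi′} {lo = lo} {hi = hi} sub (y ∷ Y) =
  case between? lo hi y of λ where
    (yes b) → subst (_≤ _) (sym (nextAccess-here b)) z≤n
    (no ¬b) → subst₂ _≤_ (sym (nextAccess-there ¬b)) (sym (nextAccess-there (¬b ∘ sub)))
                      (s≤s (nextAccess-antitone {lo′ = lo′} {hi′ = hi′} {lo = lo} {hi = hi} sub Y))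

-- Only the first query in `(lo , hi)` matters, so the two intervals may overlap in any way. If
-- there is no such query, the right-hand side is `length Y`, the largest value that occurs.
nextAccess-≤ : ∀ (Y : List (Fin n)) → Maybe.All (Between lo′ hi′) (head (restrict lo hi Y)) →
               nextAccess lo′ hi′ Y ≤ nextAccess lo hi Y
nextAccess-≤ [] next = z≤n
nextAccess-≤ {lo′ = lo′} {hi′ = hi′} {lo = lo} {hi = hi} (y ∷ Y) next =
  case between? lo′ hi′ y of λ where
    (yes b) → subst (_≤ _) (sym (nextAccess-here b)) z≤n
    (no ¬b) → case between? lo hi y of λ where
      (yes c) → ⊥-elim (¬b (Maybe.drop-just (subst (Maybe.All _ ∘ head) (filter-accept (between? lo hi) c) next)))
      (no ¬c) → subst₂ _≤_ (sym (nextAccess-there ¬b)) (sym (nextAccess-there ¬c))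
                        (s≤s (nextAccess-≤ Y (subst (Maybe.All _ ∘ head) (filter-reject (between? lo hi) ¬c) next)))

-- The first query in the larger interval is `v`, which the smaller one misses, so the smaller one
-- is hit later. The strictness makes the promotion of a key independent of ties.
nextAccess-< : (lo′ , hi′) ⊑ (lo , hi) → ∀ (Y : List (Fin n)) {F} → restrict lo hi Y ≡ v ∷ F →
               ¬ Between lo′ hi′ v → nextAccess lo hi Y ℕ.< nextAccess lo′ hi′ Y
nextAccess-< {lo′ = lo′} {hi′ = hi′} {lo = lo} {hi = hi} sub (y ∷ Y) eq ¬b =
  case between? lo hi y of λ where
    (yes c) → case trans (sym eq) (filter-accept (between? lo hi) c) of λ where
      refl → subst₂ ℕ._<_ (sym (nextAccess-here c)) (sym (nextAccess-there ¬b)) (s≤s z≤n)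
    (no ¬c) → subst₂ ℕ._<_ (sym (nextAccess-there ¬c)) (sym (nextAccess-there (¬c ∘ sub)))
                (s≤s (nextAccess-< sub Y (trans (sym (filter-reject (between? lo hi) ¬c)) eq) ¬b))

inorder : KeyTree n → List (Fin n)
inorder (leaf _)     = []
inorder (node l v r) = inorder l ++ v ∷ inorder r

-- Greedy Future on subtrees

Hanging : ℕ → Set
Hanging n = List (Fin n × ℕ × KeyTree n)

keyBefore keyAfter : Maybe (Fin n) → Hanging n → Maybe (Fin n)
keyBefore lo []             = lo
keyBefore lo ((v , _) ∷ vs) = keyBefore (just v) vs
keyAfter hi []            = hi
keyAfter hi ((v , _) ∷ _) = just v

-- The ancestors bounding a subtree entered by the query lie on the query path, so `lo` and `hi` are
-- the path neighbours of its extreme path keys. The priorities therefore agree with those computed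
-- in the whole tree.
prioritiseWithin : List (Fin n) → Maybe (Fin n) → Maybe (Fin n) → Hanging n → List (Fin n × Priority × KeyTree n)
prioritiseWithin Y lo hi []                 = []
prioritiseWithin Y lo hi ((v , d , R) ∷ vs) =
  (v , (nextAccess lo (keyAfter hi vs) Y , d) , R) ∷ prioritiseWithin Y (just v) hi vs

-- The effect of GF on a subtree at depth d whose keys are those between lo and hi,
-- provided the queried path enters it and is reordered only within it; Y is still
-- the whole future.
GFWithin : Maybe (Fin n) → Maybe (Fin n) → ℕ → Algorithm n
GFWithin lo hi d T x Y = let (R₀ , vs) = decompose x d T in reattach (treap R₀ (prioritiseWithin Y lo hi vs))

prioritise-within : ∀ Y lo (vs : Hanging n) → prioritise Y lo vs ≡ prioritiseWithin Y lo nothing vs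
prioritise-within Y lo []                             = refl
prioritise-within Y lo ((v , d , R) ∷ [])             = refl
prioritise-within Y lo ((v , d , R) ∷ vs@((w , _) ∷ _)) =
  cong ((v , (nextAccess lo (just w) Y , d) , R) ∷_) (prioritise-within Y (just v) vs)

GF-within : ∀ (T : KeyTree n) x Y → GF T x Y ≡ GFWithin nothing nothing 0 T x Y
GF-within T x Y = let (R₀ , vs) = decompose x 0 T in cong (reattach ∘ treap R₀) (prioritise-within Y nothing vs)

keyAfter-++ : ∀ (xs : Hanging n) {v d R ys} → keyAfter hi (xs ++ (v , d , R) ∷ ys) ≡ keyAfter (just v) xs
keyAfter-++ []      = refl
keyAfter-++ (_ ∷ _) = refl

prioritiseWithin-++ : ∀ Y lo (xs : Hanging n) {v d R ys} →
  prioritiseWithin Y lo hi (xs ++ (v , d , R) ∷ ys) ≡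
  prioritiseWithin Y lo (just v) xs ++
    (v , (nextAccess (keyBefore lo xs) (keyAfter hi ys) Y , d) , R) ∷ prioritiseWithin Y (just v) hi ys
prioritiseWithin-++ Y lo []                 = refl
prioritiseWithin-++ Y lo ((u , e , S) ∷ xs) =
  cong₂ (λ h → (u , (nextAccess lo h Y , e) , S) ∷_) (keyAfter-++ xs) (prioritiseWithin-++ Y (just u) xs)

-- The top of a treap

RootPriority : (Priority → Set) → Treap n → Set
RootPriority P (leaf _)           = Unit
RootPriority P (node _ (_ , q) _) = P q

Outranks : Priority → List (Fin n × Priority × KeyTree n) → Set
Outranks p = All (λ (_ , q , _) → p ≺ q)

≺-asym : ∀ {p q} → p ≺ q → ¬ q ≺ p
≺-asym (inj₁ a<b) (inj₁ b<a) = ℕ.<-asym a<b b<a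
≺-asym (inj₁ a<b) (inj₂ (refl , _)) = ℕ.<-irrefl refl a<b
≺-asym (inj₂ (refl , _)) (inj₁ b<a) = ℕ.<-irrefl refl b<a
≺-asym (inj₂ (_ , c<d)) (inj₂ (_ , d<c)) = ℕ.<-asym c<d d<c

insertMin-top : ∀ {R v p} (t : Treap n) → RootPriority (p ≺_) t → insertMin R v p t ≡ node (leaf R) (v , p) t
insertMin-top (leaf _) _ = refl
insertMin-top {p = p} (node a (w , q) b) p≺q with p ≺? q
... | yes _   = refl
... | no ¬p≺q = ⊥-elim (¬p≺q p≺q)

insertMin-below : ∀ {R u q v p} {a b : Treap n} → p ≺ q →
                  insertMin R u q (node a (v , p) b) ≡ node (insertMin R u q a) (v , p) b
insertMin-below {q = q} {p = p} p≺q with q ≺? p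
... | yes q≺p = ⊥-elim (≺-asym p≺q q≺p)
... | no _    = refl

insertMin-root : ∀ {P R v p} (t : Treap n) → P p → RootPriority P t → RootPriority P (insertMin R v p t)
insertMin-root (leaf _) Pp _ = Pp
insertMin-root {p = p} (node a (w , q) b) Pp Pq with p ≺? q
... | yes _ = Pp
... | no _  = Pq

treap-root : ∀ {P} {R : KeyTree n} {vs} → All (λ (_ , q , _) → P q) vs → RootPriority P (treap R vs)
treap-root []                   = tt
treap-root {vs = _ ∷ vs} (p ∷ ps) = insertMin-root (treap _ vs) p (treap-root ps)

-- The treap is built from the right: `v` enters on top of `treap R ys`, and each smaller key
-- inserted afterwards fails to outrank it and descends to its left.
treap-split : ∀ {R₀ v p} {R : KeyTree n} {xs ys} → Outranks p xs → Outranks p ys →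
              treap R₀ (xs ++ (v , p , R) ∷ ys) ≡ node (treap R₀ xs) (v , p) (treap R ys)
treap-split {R = R} {ys = ys} [] qs = insertMin-top (treap R ys) (treap-root qs)
treap-split                  (q ∷ ps) qs = trans (cong (insertMin _ _ _) (treap-split ps qs)) (insertMin-below q)

-- Invariance of the key order

spread : ∀ {A : Set} → List (Fin n × A × KeyTree n) → List (Fin n)
spread []                 = []
spread ((v , _ , R) ∷ vs) = v ∷ inorder R ++ spread vs

spread-++ : ∀ {A : Set} (xs : List (Fin n × A × KeyTree n)) {ys} → spread (xs ++ ys) ≡ spread xs ++ spread ys
spread-++ []                 = refl
spread-++ ((v , _ , R) ∷ xs) =
  cong (v ∷_) (trans (cong (inorder R ++_) (spread-++ xs)) (sym (++-assoc (inorder R) (spread xs) _)))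

spread-keys : ∀ {A : Set} {P : Fin n → Set} (vs : List (Fin n × A × KeyTree n)) →
              All P (spread vs) → All (P ∘ proj₁) vs
spread-keys []                 []       = []
spread-keys ((v , _ , R) ∷ vs) (p ∷ ps) = p ∷ spread-keys vs (All.++⁻ʳ (inorder R) ps)

spread-prioritiseWithin : ∀ Y lo hi (vs : Hanging n) → spread (prioritiseWithin Y lo hi vs) ≡ spread vs
spread-prioritiseWithin Y lo hi []                 = refl
spread-prioritiseWithin Y lo hi ((v , d , R) ∷ vs) =
  cong (λ ks → v ∷ inorder R ++ ks) (spread-prioritiseWithin Y (just v) hi vs)

inorder-insertMin : ∀ R v p (t : Treap n) →
                    inorder (reattach (insertMin R v p t)) ≡ inorder R ++ v ∷ inorder (reattach t)
inorder-insertMin R v p (leaf S) = refl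
inorder-insertMin R v p (node a (w , q) b) with p ≺? q
... | yes _ = refl
... | no _  = trans (cong (_++ w ∷ inorder (reattach b)) (inorder-insertMin R v p a))
                    (++-assoc (inorder R) (v ∷ inorder (reattach a)) (w ∷ inorder (reattach b)))

-- Priorities affect only the shape of the treap, so the order is the same for all of them.
inorder-treap : ∀ (R : KeyTree n) vs → inorder (reattach (treap R vs)) ≡ inorder R ++ spread vs
inorder-treap R []                 = sym (++-identityʳ (inorder R))
inorder-treap R ((v , p , S) ∷ vs) =
  trans (inorder-insertMin R v p (treap S vs)) (cong (λ ks → inorder R ++ v ∷ ks) (inorder-treap S vs))

inorder-decompose : ∀ x d (T : KeyTree n) →
                    inorder T ≡ inorder (proj₁ (decompose x d T)) ++ spread (proj₂ (decompose x d T))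
inorder-decompose x d (leaf _) = refl
inorder-decompose x d (node l k r) with <-cmp x k
... | tri< _ _ _ = let (R₀ , vs) = decompose x (suc d) l in begin
  inorder l ++ k ∷ inorder r                                 ≡⟨ cong (_++ k ∷ inorder r) (inorder-decompose x (suc d) l) ⟩
  (inorder R₀ ++ spread vs) ++ k ∷ inorder r                 ≡⟨ ++-assoc (inorder R₀) (spread vs) _ ⟩
  inorder R₀ ++ spread vs ++ k ∷ inorder r                   ≡⟨ cong (λ ks → inorder R₀ ++ spread vs ++ k ∷ ks) (++-identityʳ (inorder r)) ⟨
  inorder R₀ ++ spread vs ++ k ∷ inorder r ++ []             ≡⟨ cong (inorder R₀ ++_) (spread-++ vs) ⟨
  inorder R₀ ++ spread (vs ++ (k , d , r) ∷ [])              ∎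
  where open ≡-Reasoning
... | tri≈ _ _ _ = cong (λ ks → inorder l ++ k ∷ ks) (sym (++-identityʳ (inorder r)))
... | tri> _ _ _ = cong (λ ks → inorder l ++ k ∷ ks) (inorder-decompose x (suc d) r)

-- This invariance takes the place of preservation of the search tree property: from here on, order
-- is expressed by `Ascending` on `inorder`.
inorder-GFWithin : ∀ lo hi d (T : KeyTree n) x Y → inorder (GFWithin lo hi d T x Y) ≡ inorder T
inorder-GFWithin lo hi d T x Y = let (R₀ , vs) = decompose x d T in begin
  inorder (reattach (treap R₀ (prioritiseWithin Y lo hi vs)))  ≡⟨ inorder-treap R₀ _ ⟩
  inorder R₀ ++ spread (prioritiseWithin Y lo hi vs)           ≡⟨ cong (inorder R₀ ++_) (spread-prioritiseWithin Y lo hi vs) ⟩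
  inorder R₀ ++ spread vs                                      ≡⟨ inorder-decompose x d T ⟨
  inorder T                                                    ∎
  where open ≡-Reasoning

-- Priorities along the query path

decompose-keys : ∀ {P : Fin n → Set} x d T → All P (inorder T) → All (P ∘ proj₁) (proj₂ (decompose x d T))
decompose-keys x d T ps = let (R₀ , vs) = decompose x d T in
  spread-keys vs (All.++⁻ʳ (inorder R₀) (subst (All _) (inorder-decompose x d T) ps))

decompose-depth : ∀ (x : Fin n) d T → All (λ (_ , e , _) → d ≤ e) (proj₂ (decompose x d T))
decompose-depth x d (leaf _) = []
decompose-depth x d (node l k r) with <-cmp x k
... | tri< _ _ _ = All.++⁺ (All.map ℕ.<⇒≤ (decompose-depth x (suc d) l)) (ℕ.≤-refl ∷ [])
... | tri≈ _ _ _ = ℕ.≤-refl ∷ []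
... | tri> _ _ _ = ℕ.≤-refl ∷ All.map ℕ.<⇒≤ (decompose-depth x (suc d) r)

keyAfter-⊑ : ∀ (vs : Hanging n) → All (Between lo hi ∘ proj₁) vs → (lo′ , hi) ⊑ (lo , hi) →
             (lo′ , keyAfter hi vs) ⊑ (lo , hi)
keyAfter-⊑ []      _       sub b              = sub b
keyAfter-⊑ (_ ∷ _) (c ∷ _) sub (lo′<y , Maybe.just y<w) =
  sub (lo′<y , Maybe.map (λ w<u → <-trans y<w w<u) (proj₂ c))

-- The interval that determines τ of a path key runs between its path neighbours, hence inside
-- `(lo , hi)`, and is hit no earlier. In the recursion `lo′` becomes the path key just passed.
prioritiseWithin-≥ : ∀ {d} Y (vs : Hanging n) → All (Between lo hi ∘ proj₁) vs → (lo′ , hi) ⊑ (lo , hi) →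
                     All (λ (_ , e , _) → d ≤ e) vs →
                     All (λ (_ , (a , e) , _) → nextAccess lo hi Y ≤ a × d ≤ e) (prioritiseWithin Y lo′ hi vs)
prioritiseWithin-≥ Y []       []       sub []       = []
prioritiseWithin-≥ {lo = lo} {hi = hi} {lo′ = lo′} Y (_ ∷ vs) (b ∷ bs) sub (e ∷ es) =
  (nextAccess-antitone {lo′ = lo′} {hi′ = keyAfter hi vs} {lo = lo} {hi = hi} (keyAfter-⊑ vs bs sub) Y , e)
  ∷ prioritiseWithin-≥ Y vs bs (above-⊑ b) es

keyBefore-< : ∀ (vs : Hanging n) → Maybe.All (_< y) lo → All (λ h → proj₁ h < y) vs → Maybe.All (_< y) (keyBefore lo vs)
keyBefore-< []       lo<y []         = lo<y
keyBefore-< (_ ∷ vs) lo<y (v<y ∷ vs<y) = keyBefore-< vs (Maybe.just v<y) vs<y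

keyAfter-> : ∀ (vs : Hanging n) → Maybe.All (y <_) hi → All (λ h → y < proj₁ h) vs → Maybe.All (y <_) (keyAfter hi vs)
keyAfter-> []      y<hi []        = y<hi
keyAfter-> (_ ∷ _) y<hi (y<v ∷ _) = Maybe.just y<v

head-All : ∀ {P : Fin n → Set} {xs} → All P xs → Maybe.All P (head xs)
head-All []      = Maybe.nothing
head-All (p ∷ _) = Maybe.just p

next-between : ∀ lo hi (Y : List (Fin n)) → Maybe.All (Between lo hi) (head (restrict lo hi Y))
next-between lo hi Y = head-All (All.all-filter (between? lo hi) Y)

-- Keeping and replacing the root of a subtree

outranks : ∀ {a d b e} → a ≤ b → d ℕ.< e → (a , d) ≺ (b , e)
outranks a≤b d<e with ℕ.m≤n⇒m<n∨m≡n a≤b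
... | inj₁ a<b = inj₁ a<b
... | inj₂ a≡b = inj₂ (a≡b , d<e)

maybe-zip : ∀ {P Q R : Fin n → Set} {m : Maybe (Fin n)} → (∀ {y} → P y → Q y → R y) →
            Maybe.All P m → Maybe.All Q m → Maybe.All R m
maybe-zip f (Maybe.just p) (Maybe.just q) = Maybe.just (f p q)
maybe-zip f Maybe.nothing  Maybe.nothing  = Maybe.nothing

-- If the next query of the subtree lies beyond all path keys in `l`, it falls in the interval that
-- determines τ of `v`. So τ of `v` is minimal, and a tie with a deeper key goes to `v`. If no such
-- query follows, all these τ are infinite and depth decides again.
GFWithin-left : ∀ {d} (l r : KeyTree n) Y → x < v → All (Between lo (just v)) (inorder l) → Between lo hi v →
  Maybe.All (λ y → All (λ h → proj₁ h < y) (proj₂ (decompose x (suc d) l))) (head (restrict lo hi Y)) →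
  GFWithin lo hi d (node l v r) x Y ≡ node (GFWithin lo (just v) (suc d) l x Y) v r
GFWithin-left {x = x} {v = v} {lo = lo} {hi = hi} {d = d} l r Y x<v bl bv next with <-cmp x v
... | tri≈ _ refl _  = ⊥-elim (<-irrefl refl x<v)
... | tri> _ _ v<x  = ⊥-elim (<-asym x<v v<x)
... | tri< _ _ _ = let (R₀ , vs) = decompose x (suc d) l in
  cong reattach (trans (cong (treap R₀) (prioritiseWithin-++ Y lo vs))
    (treap-split (All.map (λ (a≤ , d<) → outranks
      (ℕ.≤-trans (nextAccess-≤ {lo′ = keyBefore lo vs} {hi′ = hi} {lo = lo} {hi = hi} Y
         (maybe-zip (λ { (lo<y , y<hi) vs<y → keyBefore-< vs lo<y vs<y , y<hi }) (next-between lo hi Y) next))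
        (ℕ.≤-trans (nextAccess-antitone {lo′ = lo} {hi′ = just v} {lo = lo} {hi = hi} (below-⊑ bv) Y) a≤)) d<)
      (prioritiseWithin-≥ Y vs (decompose-keys x (suc d) l bl) ⊑-refl (decompose-depth x (suc d) l))) []))

GFWithin-right : ∀ {d} (l r : KeyTree n) Y → v < x → All (Between (just v) hi) (inorder r) → Between lo hi v →
  Maybe.All (λ y → All (λ h → y < proj₁ h) (proj₂ (decompose x (suc d) r))) (head (restrict lo hi Y)) →
  GFWithin lo hi d (node l v r) x Y ≡ node l v (GFWithin (just v) hi (suc d) r x Y)
GFWithin-right {v = v} {x = x} {hi = hi} {lo = lo} {d = d} l r Y v<x br bv next with <-cmp x v
... | tri≈ _ refl _  = ⊥-elim (<-irrefl refl v<x)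
... | tri< x<v _ _  = ⊥-elim (<-asym x<v v<x)
... | tri> _ _ _ = let (R₀ , vs) = decompose x (suc d) r in
  cong reattach
    (treap-split [] (All.map (λ (a≤ , d<) → outranks
      (ℕ.≤-trans (nextAccess-≤ {lo′ = lo} {hi′ = keyAfter hi vs} {lo = lo} {hi = hi} Y
         (maybe-zip (λ { (lo<y , y<hi) y<vs → lo<y , keyAfter-> vs y<hi y<vs }) (next-between lo hi Y) next))
        (ℕ.≤-trans (nextAccess-antitone {lo′ = just v} {hi′ = hi} {lo = lo} {hi = hi} (above-⊑ bv) Y) a≤)) d<)
      (prioritiseWithin-≥ Y vs (decompose-keys x (suc d) r br) ⊑-refl (decompose-depth x (suc d) r))))

GFWithin-root : ∀ {d} (l r : KeyTree n) Y → GFWithin lo hi d (node l v r) v Y ≡ node l v r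
GFWithin-root {v = v} l r Y with <-cmp v v
... | tri< v<v _ _ = ⊥-elim (<-irrefl refl v<v)
... | tri≈ _ _ _   = refl
... | tri> _ _ v<v = ⊥-elim (<-irrefl refl v<v)

decompose-∈ : ∀ {S : KeyTree n} d → Ascending lo hi (inorder S) → v ∈ inorder S →
              ∃[ xs ] ∃[ e ] ∃[ R ] ∃[ ys ] proj₂ (decompose v d S) ≡ xs ++ (v , e , R) ∷ ys
decompose-∈ {lo = lo} {v = v} {S = node l k r} d asc v∈ with <-cmp v k | ascending-split lo (inorder l) asc | ∈-++⁻ (inorder l) v∈
... | tri≈ _ refl _ | _            | _                 = [] , d , r , [] , refl
... | tri< v<k _ _  | al , _ , _   | inj₁ v∈l          = case decompose-∈ {S = l} (suc d) al v∈l of λ where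
  (xs , e , R , ys , eq) → xs , e , R , ys ++ (k , d , r) ∷ [] ,
                           trans (cong (_++ (k , d , r) ∷ []) eq) (++-assoc xs _ _)
... | tri< v<k _ _  | _            | inj₂ (here refl)  = ⊥-elim (<-irrefl refl v<k)
... | tri< v<k _ _  | _ , _ , ar   | inj₂ (there v∈r)  =
  ⊥-elim (<-asym v<k (above> (All.lookup (ascending⇒between (just k) (inorder r) ar) v∈r)))
... | tri> _ _ k<v  | al , _ , _   | inj₁ v∈l          =
  ⊥-elim (<-asym k<v (below< (All.lookup (ascending⇒between _ (inorder l) al) v∈l)))
... | tri> _ _ k<v  | _            | inj₂ (here refl)  = ⊥-elim (<-irrefl refl k<v)
... | tri> _ _ k<v  | _ , _ , ar   | inj₂ (there v∈r)  = case decompose-∈ {S = r} (suc d) ar v∈r of λ where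
  (xs , e , R , ys , eq) → (k , d , proj₁ (decompose v (suc d) r)) ∷ xs , e , R , ys , cong (_ ∷_) eq

-- The next query of the subtree is `v` once more. It hits the interval of `v` itself, whereas the
-- intervals of all other path keys lie on one side of `v` and are hit strictly later. This is why a
-- tour begins with its root twice.
GFWithin-promote : ∀ {S : KeyTree n} d Y → Ascending lo hi (inorder S) → v ∈ inorder S → restrict lo hi Y ≡ v ∷ F →
                   ∃[ l ] ∃[ r ] GFWithin lo hi d S v Y ≡ node l v r
GFWithin-promote {lo = lo} {hi = hi} {v = v} {S = S} d Y asc v∈ next with decompose v d S | inorder-decompose v d S | decompose-∈ {S = S} d asc v∈
... | R₀ , .(xs ++ (v , e , R) ∷ ys) | order | xs , e , R , ys , refl = 
  reattach (treap R₀ (prioritiseWithin Y lo (just v) xs)) , reattach (treap R (prioritiseWithin Y (just v) hi ys)) ,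
  cong reattach (trans (cong (treap R₀) (prioritiseWithin-++ Y lo xs))
    (treap-split
      (All.map (λ (a≤ , _) → inj₁ (ℕ.≤-trans (ℕ.≤-<-trans v-first (nextAccess-< (below-⊑ bv) Y next v∉below)) a≤))
        (prioritiseWithin-≥ {hi = just v} Y xs xs<v ⊑-refl (All.universal (λ _ → z≤n) xs)))
      (All.map (λ (a≤ , _) → inj₁ (ℕ.≤-trans (ℕ.≤-<-trans v-first (nextAccess-< (above-⊑ bv) Y next v∉above)) a≤))
        (prioritiseWithin-≥ {lo = just v} {hi = hi} Y ys v<ys ⊑-refl (All.universal (λ _ → z≤n) ys)))))
  where
  split = ascending-split {hi = hi} lo (inorder R₀ ++ spread xs)
            (subst (Ascending lo hi) (trans order (trans (cong (inorder R₀ ++_) (spread-++ xs))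
              (sym (++-assoc (inorder R₀) (spread xs) _)))) asc)
  bv = proj₁ (proj₂ split)
  xs<v = spread-keys xs (All.++⁻ʳ (inorder R₀) (ascending⇒between lo _ (proj₁ split)))
  v<ys = spread-keys ys (All.++⁻ʳ (inorder R) (ascending⇒between (just v) _ (proj₂ (proj₂ split))))
  v-first : nextAccess (keyBefore lo xs) (keyAfter hi ys) Y ≤ nextAccess lo hi Y
  v-first = nextAccess-≤ {lo′ = keyBefore lo xs} {hi′ = keyAfter hi ys} {lo = lo} {hi = hi} Y
    (subst (Maybe.All _ ∘ head) (sym next) (Maybe.just
      (keyBefore-< xs (proj₁ bv) (All.map below< xs<v) , keyAfter-> ys (proj₂ bv) (All.map above> v<ys))))

-- Turning one search tree into another by queries

-- Serves Y lo hi d T Q T′: the queries of Q lying in the interval turn T into T′,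
-- when Y is to be queried after Q.
data Serves (Y : List (Fin n)) (lo hi : Maybe (Fin n)) (d : ℕ) : KeyTree n → List (Fin n) → KeyTree n → Set where
  done  : Serves Y lo hi d T [] T
  skip  : ¬ Between lo hi x → Serves Y lo hi d T Q T′ → Serves Y lo hi d T (x ∷ Q) T′
  serve : Between lo hi x → Serves Y lo hi d (GFWithin lo hi d T x (Q ++ Y)) Q T′ → Serves Y lo hi d T (x ∷ Q) T′

-- The pattern that keeps `v` at the root: a query elsewhere is followed at once by one to `v`.
data Returning (v : Fin n) : List (Fin n) → Set where
  []   : Returning v []
  at   : Returning v F → Returning v (v ∷ F)
  back : Returning v F → Returning v (y ∷ v ∷ F)

returning-tail : Returning v (x ∷ F) → Returning v F
returning-tail (at rs)   = rs
returning-tail (back rs) = at rs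

returning-next : x ≢ v → Returning v (x ∷ F) → ∃[ F′ ] F ≡ v ∷ F′
returning-next x≢v (at _)   = ⊥-elim (x≢v refl)
returning-next x≢v (back _) = _ , refl

between-cases : Between lo hi x → ∀ v → Between lo (just v) x ⊎ x ≡ v ⊎ Between (just v) hi x
between-cases {x = x} b v with <-cmp x v
... | tri< x<v _ _ = inj₁ (toBelow b x<v)
... | tri≈ _ x≡v _ = inj₂ (inj₁ x≡v)
... | tri> _ _ v<x = inj₂ (inj₂ (toAbove b v<x))

-- After a query into one subtree the next query in `(lo , hi)` is `v`, which lies beyond every path
-- key of that subtree, so the root stays. Thus one interleaved sequence serves both subtrees
-- independently.
serves-node : Returning v (restrict lo hi Q) → Between lo hi v →
              All (Between lo (just v)) (inorder l) → All (Between (just v) hi) (inorder r) →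
              Serves Y lo (just v) (suc d) l Q l′ → Serves Y (just v) hi (suc d) r Q r′ →
              Serves Y lo hi d (node l v r) Q (node l′ v r′)
serves-node ret bv bl br done done = done
serves-node {v = v} {lo = lo} {hi = hi} {l = l} {r = r} ret bv bl br (skip {x = x} {Q = Q} ¬below sl) (skip ¬above sr) =
  case between? lo hi x of λ where
    (no ¬b) → skip ¬b (serves-node (subst (Returning v) (filter-reject (between? lo hi) ¬b) ret) bv bl br sl sr)
    (yes b) → case between-cases b v of λ where
      (inj₁ below)        → ⊥-elim (¬below below)
      (inj₂ (inj₂ above)) → ⊥-elim (¬above above)
      (inj₂ (inj₁ refl))  → serve b (subst (λ T → Serves _ lo hi _ T Q _) (sym (GFWithin-root l r _))
        (serves-node (returning-tail (subst (Returning v) (filter-accept (between? lo hi) b) ret)) bv bl br sl sr))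
serves-node {v = v} {lo = lo} {hi = hi} {l = l} {r = r} {Y = Y} ret bv bl br (serve {x = x} {Q = Q} below sl) (skip _ sr) =
  let ret′ = subst (Returning v) (filter-accept (between? lo hi) (below-⊑ bv below)) ret
      F′ , next = returning-next (λ { refl → v∉below below }) ret′
  in serve (below-⊑ bv below) (subst (λ T → Serves _ lo hi _ T Q _)
       (sym (GFWithin-left l r _ (below< below) bl bv
         (subst (Maybe.All _ ∘ head) (sym (trans (filter-++ (between? lo hi) Q Y) (cong (_++ restrict lo hi Y) next)))
           (Maybe.just (All.map below< (decompose-keys x _ l bl))))))
       (serves-node (returning-tail ret′) bv (subst (All _) (sym (inorder-GFWithin lo (just v) _ l x (Q ++ Y))) bl) br sl sr))
serves-node {v = v} {lo = lo} {hi = hi} {l = l} {r = r} {Y = Y} ret bv bl br (skip _ sl) (serve {x = x} {Q = Q} above sr) =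
  let ret′ = subst (Returning v) (filter-accept (between? lo hi) (above-⊑ bv above)) ret
      F′ , next = returning-next (λ { refl → v∉above above }) ret′
  in serve (above-⊑ bv above) (subst (λ T → Serves _ lo hi _ T Q _)
       (sym (GFWithin-right l r _ (above> above) br bv
         (subst (Maybe.All _ ∘ head) (sym (trans (filter-++ (between? lo hi) Q Y) (cong (_++ restrict lo hi Y) next)))
           (Maybe.just (All.map above> (decompose-keys x _ r br))))))
       (serves-node (returning-tail ret′) bv bl (subst (All _) (sym (inorder-GFWithin (just v) hi _ r x (Q ++ Y))) br) sl sr))
serves-node ret bv bl br (serve below _) (serve above _) = ⊥-elim (<-asym (below< below) (above> above))

serves-none : ∀ Q → restrict lo hi Q ≡ [] → Serves Y lo hi d T Q T
serves-none []      eq = done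
serves-none {lo = lo} {hi = hi} (x ∷ Q) eq = case between? lo hi x of λ where
  (yes b) → case trans (sym eq) (filter-accept (between? lo hi) b) of λ ()
  (no ¬b) → skip ¬b (serves-none Q (trans (sym (filter-reject (between? lo hi) ¬b)) eq))

-- Between any two queries to other keys of a subtree its root is queried, which
-- keeps it at the top; the first of the two initial queries brings it there.
comeBack : Fin n → List (Fin n) → List (Fin n)
comeBack v []       = []
comeBack v (y ∷ ys) = y ∷ v ∷ comeBack v ys

tour : KeyTree n → List (Fin n)
tour (leaf _)     = []
tour (node l v r) = v ∷ v ∷ comeBack v (tour l ++ tour r)

comeBack-returning : ∀ (ys : List (Fin n)) → Returning v (comeBack v ys)
comeBack-returning []       = []
comeBack-returning (y ∷ ys) = back (comeBack-returning ys)

comeBack-All : ∀ {P : Fin n → Set} → P v → ∀ {ys} → All P ys → All P (comeBack v ys)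
comeBack-All p []       = []
comeBack-All p (q ∷ qs) = q ∷ p ∷ comeBack-All p qs

tour-All : ∀ {P : Fin n → Set} T → All P (inorder T) → All P (tour T)
tour-All (leaf _)     _  = []
tour-All (node l v r) ps with All.++⁻ʳ (inorder l) ps
... | p ∷ qs = p ∷ p ∷ comeBack-All p (All.++⁺ (tour-All l (All.++⁻ˡ (inorder l) ps)) (tour-All r qs))

restrict-comeBack : ¬ Between lo hi v → ∀ ys → restrict lo hi (comeBack v ys) ≡ restrict lo hi ys
restrict-comeBack ¬b [] = refl
restrict-comeBack {lo = lo} {hi = hi} {v = v} ¬b (y ∷ ys) = case between? lo hi y of λ where
    (yes c) → trans (filter-accept (between? lo hi) c) (trans (cong (y ∷_) tail) (sym (filter-accept (between? lo hi) c)))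
    (no ¬c) → trans (filter-reject (between? lo hi) ¬c) (trans tail (sym (filter-reject (between? lo hi) ¬c)))
  where
  tail : restrict lo hi (v ∷ comeBack v ys) ≡ restrict lo hi ys
  tail = trans (filter-reject (between? lo hi) ¬b) (restrict-comeBack ¬b ys)

-- A prefix running past the `v` of the other list would contain `v`, although all its keys are
-- smaller.
split-unique : ∀ {xs xs′ ys ys′ : List (Fin n)} → All (_< v) xs → All (_< v) xs′ →
               xs ++ v ∷ ys ≡ xs′ ++ v ∷ ys′ → xs ≡ xs′ × ys ≡ ys′
split-unique []         []         refl = refl , refl
split-unique []         (v<v ∷ _)  refl = ⊥-elim (<-irrefl refl v<v)
split-unique (v<v ∷ _)  []         refl = ⊥-elim (<-irrefl refl v<v)
split-unique (_ ∷ ps)   (_ ∷ qs)   eq   with ∷-injective eq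
... | refl , eq′ with split-unique ps qs eq′
...   | refl , refl = refl , refl

inorder-empty : ∀ (S : KeyTree n) → inorder S ≡ [] → S ≡ leaf tt
inorder-empty (leaf _)     _  = refl
inorder-empty (node l v r) eq with inorder l
inorder-empty (node l v r) () | []
inorder-empty (node l v r) () | _ ∷ _

-- The hypothesis fixes only the queries falling in the interval, so it passes to both subtrees at
-- once, although their tours are interleaved with other queries.
tour-forces : ∀ (T S : KeyTree n) Q → Ascending lo hi (inorder T) → inorder S ≡ inorder T →
              restrict lo hi Q ≡ tour T → Serves Y lo hi d S Q T
tour-forces (leaf _) S Q asc eq queries with inorder-empty S eq
... | refl = serves-none Q queries
tour-forces {lo = lo} {hi = hi} {Y = Y} {d = d} T@(node l v r) S (x ∷ Q) asc eq queries = case between? lo hi x of λ where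
    (no ¬b) → skip ¬b (tour-forces T S Q asc eq (trans (sym (filter-reject (between? lo hi) ¬b)) queries))
    (yes b) → case ∷-injective (trans (sym (filter-accept (between? lo hi) b)) queries) of λ where
      (refl , queries′) →
        let al , bv , ar = ascending-split lo (inorder l) asc
            bl = ascending⇒between lo (inorder l) al
            br = ascending⇒between (just v) (inorder r) ar
            -- The second of the two initial queries to `v` is the next one, so the first already
            -- lifts `v` to the root.
            l′ , r′ , eq′ = GFWithin-promote {S = S} d (Q ++ Y) (subst (Ascending lo hi) (sym eq) asc)
              (subst (v ∈_) (sym eq) (∈-++⁺ʳ (inorder l) (here refl)))
              (trans (filter-++ (between? lo hi) Q Y) (cong (_++ restrict lo hi Y) queries′))
            order = trans (cong inorder (sym eq′)) (trans (inorder-GFWithin lo hi d S v (Q ++ Y)) eq)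
            al′ , _ , _ = ascending-split lo (inorder l′) (subst (Ascending lo hi) (sym order) asc)
            eql , eqr = split-unique (All.map below< (ascending⇒between lo (inorder l′) al′)) (All.map below< bl) order
            visits = All.++⁺ (tour-All l (All.map inj₁ bl)) (tour-All r (All.map inj₂ br))
        in serve b (subst (λ T → Serves Y lo hi d T Q _) (sym eq′)
          (serves-node (subst (Returning v) (sym queries′) (at (comeBack-returning (tour l ++ tour r)))) bv
            (subst (All _) (sym eql) bl) (subst (All _) (sym eqr) br)
            -- The returns to `v` and the tour of the other subtree fall outside the interval, which
            -- leaves `tour l`.
            (tour-forces l l′ Q al eql (begin
              restrict lo (just v) Q                                  ≡⟨ restrict-⊑ (below-⊑ bv) Q ⟨
              restrict lo (just v) (restrict lo hi Q)                 ≡⟨ cong (restrict lo (just v)) queries′ ⟩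
              restrict lo (just v) (v ∷ comeBack v (tour l ++ tour r)) ≡⟨ filter-reject (between? lo (just v)) v∉below ⟩
              restrict lo (just v) (comeBack v (tour l ++ tour r))    ≡⟨ restrict-comeBack v∉below (tour l ++ tour r) ⟩
              restrict lo (just v) (tour l ++ tour r)                 ≡⟨ filter-++ (between? lo (just v)) (tour l) (tour r) ⟩
              restrict lo (just v) (tour l) ++ restrict lo (just v) (tour r)
                ≡⟨ cong₂ _++_ (filter-all (between? lo (just v)) (tour-All l bl))
                              (filter-none (between? lo (just v)) (All.map (v<y⇒y∉below ∘ above>) (tour-All r br))) ⟩
              tour l ++ []                                            ≡⟨ ++-identityʳ (tour l) ⟩
              tour l                                                  ∎))
            (tour-forces r r′ Q ar eqr (begin
              restrict (just v) hi Q                                  ≡⟨ restrict-⊑ (above-⊑ bv) Q ⟨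
              restrict (just v) hi (restrict lo hi Q)                 ≡⟨ cong (restrict (just v) hi) queries′ ⟩
              restrict (just v) hi (v ∷ comeBack v (tour l ++ tour r)) ≡⟨ filter-reject (between? (just v) hi) v∉above ⟩
              restrict (just v) hi (comeBack v (tour l ++ tour r))    ≡⟨ restrict-comeBack v∉above (tour l ++ tour r) ⟩
              restrict (just v) hi (tour l ++ tour r)                 ≡⟨ filter-++ (between? (just v) hi) (tour l) (tour r) ⟩
              restrict (just v) hi (tour l) ++ restrict (just v) hi (tour r)
                ≡⟨ cong₂ _++_ (filter-none (between? (just v) hi) (All.map (y<v⇒y∉above ∘ below<) (tour-All l bl)))
                              (filter-all (between? (just v) hi) (tour-All r br)) ⟩
              tour r                                                  ∎))))
  where open ≡-Reasoning

-- Trees left unchanged by Greedy Future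

-- After the query x, with y the next query in the subtree node l v r, no key of the
-- query path other than v separates v from y.  Then v is accessed no later than any
-- path key below it, and stays on top, possibly as the winner of a tie.
Calm : KeyTree n → Fin n → KeyTree n → Fin n → Fin n → Set
Calm l v r x y = ∀ d → (x < v → All (λ h → proj₁ h < y) (proj₂ (decompose x d l))) ×
                       (v < x → All (λ h → y < proj₁ h) (proj₂ (decompose x d r)))

-- Two queries are consecutive for a node if no query of the interval of its subtree lies between
-- them.
Calmly : Maybe (Fin n) → Maybe (Fin n) → KeyTree n → List (Fin n) → Set
Calmly lo hi (leaf _)     F = Unit
Calmly lo hi (node l v r) F =
  Linked (Calm l v r) F × Calmly lo (just v) l (restrict lo (just v) F) × Calmly (just v) hi r (restrict (just v) hi F)

calm-root : Calm l v r v y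
calm-root d = (λ v<v → ⊥-elim (<-irrefl refl v<v)) , (λ v<v → ⊥-elim (<-irrefl refl v<v))

calm-rightwards : All (_< v) (inorder l) → x < v → v < y → Calm l v r x y
calm-rightwards {l = l} {x = x} bl x<v v<y d =
  (λ _ → All.map (λ u<v → <-trans u<v v<y) (decompose-keys x d l bl)) , (λ v<x → ⊥-elim (<-asym x<v v<x))

calm-leftwards : All (v <_) (inorder r) → v < x → y < v → Calm l v r x y
calm-leftwards {r = r} {x = x} br v<x y<v d =
  (λ x<v → ⊥-elim (<-asym x<v v<x)) , (λ _ → All.map (<-trans y<v) (decompose-keys x d r br))

calm-return : All (v <_) (inorder r) → v < x → Calm l v r x v
calm-return {r = r} {x = x} br v<x d =
  (λ x<v → ⊥-elim (<-asym x<v v<x)) , (λ _ → decompose-keys x d r br)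

linked-next : ∀ {R : Fin n → Fin n → Set} → Linked R (x ∷ F) → Maybe.All (R x) (head F)
linked-next [-]      = Maybe.nothing
linked-next (r ∷ _) = Maybe.just r

linked-tail : ∀ {R : Fin n → Fin n → Set} → Linked R (x ∷ F) → Linked R F
linked-tail [-]      = []
linked-tail (_ ∷ rs) = rs

calmly-tail : ∀ T → Calmly lo hi T (x ∷ F) → Calmly {n} lo hi T F
calmly-tail (leaf _) _ = tt
calmly-tail {lo = lo} {hi = hi} {x = x} {F = F} (node l v r) (linked , cl , cr) =
  linked-tail linked , tail-restrict lo (just v) l cl , tail-restrict (just v) hi r cr
  where
  tail-restrict : ∀ lo hi T → Calmly lo hi T (restrict lo hi (x ∷ F)) → Calmly lo hi T (restrict lo hi F)
  tail-restrict lo hi T c = case between? lo hi x of λ where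
    (yes b) → calmly-tail T (subst (Calmly lo hi T) (filter-accept (between? lo hi) b) c)
    (no ¬b) → subst (Calmly lo hi T) (filter-reject (between? lo hi) ¬b) c

calmly-[] : ∀ lo hi T → Calmly {n} lo hi T []
calmly-[] lo hi (leaf _)     = tt
calmly-[] lo hi (node l v r) = [] , calmly-[] lo (just v) l , calmly-[] (just v) hi r

-- At each node of the query path `Calm` keeps the root, which reduces the claim to the child
-- entered. After the last query of a subtree all its τ are infinite, and the depths preserve the
-- shape.
GFWithin-calm : ∀ d T Y → Ascending lo hi (inorder T) → Between lo hi x → Calmly lo hi T (restrict lo hi (x ∷ Y)) →
                GFWithin {n} lo hi d T x Y ≡ T
GFWithin-calm d (leaf _) Y asc b calm = refl
GFWithin-calm {lo = lo} {hi = hi} {x = x} d (node l v r) Y asc b (linked , cl , cr)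
  with ascending-split lo (inorder l) asc | between-cases b v
... | al , bv , ar | inj₁ below =
  trans (GFWithin-left l r Y (below< below) (ascending⇒between lo (inorder l) al) bv
          (Maybe.map (λ c → proj₁ (c _) (below< below)) (linked-next (subst (Linked _) (filter-accept (between? lo hi) b) linked))))
        (cong (λ l → node l v r) (GFWithin-calm (suc d) l Y al below
          (subst (Calmly lo (just v) l) (restrict-⊑ (below-⊑ bv) (x ∷ Y)) cl)))
... | al , bv , ar | inj₂ (inj₁ refl)  = GFWithin-root l r Y
... | al , bv , ar | inj₂ (inj₂ above) =
  trans (GFWithin-right l r Y (above> above) (ascending⇒between (just v) (inorder r) ar) bv
          (Maybe.map (λ c → proj₂ (c _) (above> above)) (linked-next (subst (Linked _) (filter-accept (between? lo hi) b) linked))))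
        (cong (node l v) (GFWithin-calm (suc d) r Y ar above
          (subst (Calmly (just v) hi r) (restrict-⊑ (above-⊑ bv) (x ∷ Y)) cr)))

-- Costs

∣p∪q∣≤∣p∣+∣q∣ : ∀ (p q : Subset n) → ∣ p ∪ q ∣ ≤ ∣ p ∣ + ∣ q ∣
∣p∪q∣≤∣p∣+∣q∣ []            []            = z≤n
∣p∪q∣≤∣p∣+∣q∣ (outside ∷ p) (outside ∷ q) = ∣p∪q∣≤∣p∣+∣q∣ p q
∣p∪q∣≤∣p∣+∣q∣ (outside ∷ p) (inside ∷ q)  =
  ℕ.≤-trans (s≤s (∣p∪q∣≤∣p∣+∣q∣ p q)) (ℕ.≤-reflexive (sym (ℕ.+-suc ∣ p ∣ ∣ q ∣)))
∣p∪q∣≤∣p∣+∣q∣ (inside ∷ p)  (outside ∷ q) = s≤s (∣p∪q∣≤∣p∣+∣q∣ p q)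
∣p∪q∣≤∣p∣+∣q∣ (inside ∷ p)  (inside ∷ q)  =
  s≤s (ℕ.≤-trans (∣p∪q∣≤∣p∣+∣q∣ p q) (ℕ.+-monoʳ-≤ ∣ p ∣ (ℕ.n≤1+n ∣ q ∣)))

∣⁅k⁆∪p∣≤1+∣p∣ : ∀ (k : Fin n) p → ∣ ⁅ k ⁆ ∪ p ∣ ≤ suc ∣ p ∣
∣⁅k⁆∪p∣≤1+∣p∣ k p = ℕ.≤-trans (∣p∪q∣≤∣p∣+∣q∣ ⁅ k ⁆ p) (ℕ.≤-reflexive (cong (_+ ∣ p ∣) (∣⁅x⁆∣≡1 k)))

pathLength : Fin n → KeyTree n → ℕ
pathLength x (leaf _) = 0
pathLength x (node l k r) with <-cmp x k
... | tri< _ _ _ = suc (pathLength x l)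
... | tri≈ _ _ _ = 1
... | tri> _ _ _ = suc (pathLength x r)

∣path∣≤pathLength : ∀ (x : Fin n) T → ∣ path x T ∣ ≤ pathLength x T
∣path∣≤pathLength {n} x (leaf _) = ℕ.≤-reflexive (∣⊥∣≡0 n)
∣path∣≤pathLength x (node l k r) with <-cmp x k
... | tri< _ _ _ = ℕ.≤-trans (∣⁅k⁆∪p∣≤1+∣p∣ k _) (s≤s (∣path∣≤pathLength x l))
... | tri≈ _ _ _ = ℕ.≤-reflexive (∣⁅x⁆∣≡1 k)
... | tri> _ _ _ = ℕ.≤-trans (∣⁅k⁆∪p∣≤1+∣p∣ k _) (s≤s (∣path∣≤pathLength x r))

path-keys : ∀ {P : Fin n → Set} x T → All P (inorder T) → ∀ {y} → y ∈ˢ path x T → P y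
path-keys x (leaf _)     _  y∈ = ⊥-elim (∉⊥ y∈)
path-keys x (node l k r) ps y∈ with All.++⁻ʳ (inorder l) ps | <-cmp x k
... | p ∷ _ | tri≈ _ _ _ = subst _ (sym (x∈⁅y⁆⇒x≡y k y∈)) p
... | p ∷ _ | tri< _ _ _ with x∈p∪q⁻ ⁅ k ⁆ (path x l) y∈
...   | inj₁ y∈k = subst _ (sym (x∈⁅y⁆⇒x≡y k y∈k)) p
...   | inj₂ y∈l = path-keys x l (All.++⁻ˡ (inorder l) ps) y∈l
path-keys x (node l k r) ps y∈ | p ∷ qs | tri> _ _ _ with x∈p∪q⁻ ⁅ k ⁆ (path x r) y∈
...   | inj₁ y∈k = subst _ (sym (x∈⁅y⁆⇒x≡y k y∈k)) p
...   | inj₂ y∈r = path-keys x r qs y∈r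

1+∣p∣≤∣⁅k⁆∪p∣ : ∀ {k : Fin n} p → k ∉ˢ p → suc ∣ p ∣ ≤ ∣ ⁅ k ⁆ ∪ p ∣
1+∣p∣≤∣⁅k⁆∪p∣ {k = k} p k∉p = p⊂q⇒∣p∣<∣q∣ (q⊆p∪q ⁅ k ⁆ p , k , p⊆p∪q p (x∈⁅x⁆ k) , k∉p)

-- A repeated key would make the path smaller as a set. The order excludes this, because a key never
-- occurs in its own subtrees.
pathLength≤∣path∣ : ∀ (x : Fin n) T → Ascending lo hi (inorder T) → pathLength x T ≤ ∣ path x T ∣
pathLength≤∣path∣ x (leaf _) asc = z≤n
pathLength≤∣path∣ {lo = lo} x (node l k r) asc with ascending-split lo (inorder l) asc | <-cmp x k
... | al , _ , _ | tri< _ _ _ = ℕ.≤-trans (s≤s (pathLength≤∣path∣ x l al))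
  (1+∣p∣≤∣⁅k⁆∪p∣ (path x l) (λ k∈ → v∉below (path-keys x l (ascending⇒between lo (inorder l) al) k∈)))
... | _ , _ , _  | tri≈ _ _ _ = ℕ.≤-reflexive (sym (∣⁅x⁆∣≡1 k))
... | _ , _ , ar | tri> _ _ _ = ℕ.≤-trans (s≤s (pathLength≤∣path∣ x r ar))
  (1+∣p∣≤∣⁅k⁆∪p∣ (path x r) (λ k∈ → v∉above (path-keys x r (ascending⇒between (just k) (inorder r) ar) k∈)))

rotatedEnds-refl : ∀ (T : KeyTree n) → rotatedEnds T T ≡ ⊥
rotatedEnds-refl (leaf _) = refl
rotatedEnds-refl (node l k r) with <-cmp k k
... | tri< k<k _ _ = ⊥-elim (<-irrefl refl k<k)
... | tri> _ _ k<k = ⊥-elim (<-irrefl refl k<k)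
... | tri≈ _ _ _   =
  trans (cong (⊥ ∪_) (cong₂ _∪_ (rotatedEnds-refl l) (rotatedEnds-refl r)))
        (trans (∪-identityˡ (⊥ ∪ ⊥)) (∪-identityˡ ⊥))

-- The empty set is contained in the keys of every left subtree, so the descent follows the left
-- spine down to a leaf.
spannedSubtree-⊥ : ∀ (T : KeyTree n) → spannedSubtree ⊥ T ≡ ⊥
spannedSubtree-⊥ (leaf _) = refl
spannedSubtree-⊥ (node l k r) with ⊥ ⊆? keys l
... | yes _ = spannedSubtree-⊥ l
... | no ⊥⊈ = ⊥-elim (⊥⊈ ⊥⊆)

stepCost-unchanged : ∀ (T : KeyTree n) x → stepCost T x T ≡ ∣ path x T ∣
stepCost-unchanged T x = cong ∣_∣ (trans
  (cong (path x T ∪_) (trans (cong (λ S → spannedSubtree S T) (rotatedEnds-refl T)) (spannedSubtree-⊥ T)))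
  (∪-identityʳ (path x T)))

totalLength : KeyTree n → List (Fin n) → ℕ
totalLength T []      = 0
totalLength T (x ∷ F) = pathLength x T + totalLength T F

restrict-everything : ∀ (Q : List (Fin n)) → restrict nothing nothing Q ≡ Q
restrict-everything Q = filter-all (between? nothing nothing) (All.universal (λ _ → Maybe.nothing , Maybe.nothing) Q)

GF-calm : ∀ (T : KeyTree n) x Q → Ascending nothing nothing (inorder T) → Calmly nothing nothing T (x ∷ Q) → GF T x Q ≡ T
GF-calm T x Q asc calm = trans (GF-within T x Q) (GFWithin-calm 0 T Q asc (Maybe.nothing , Maybe.nothing)
  (subst (Calmly nothing nothing T) (sym (restrict-everything (x ∷ Q))) calm))

cost-calm-≤ : ∀ (T : KeyTree n) Q → Ascending nothing nothing (inorder T) → Calmly nothing nothing T Q →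
              cost GF Q T ≤ totalLength T Q
cost-calm-≤ T []      asc calm = z≤n
cost-calm-≤ T (x ∷ Q) asc calm rewrite GF-calm T x Q asc calm | stepCost-unchanged T x =
  ℕ.+-mono-≤ (∣path∣≤pathLength x T) (cost-calm-≤ T Q asc (calmly-tail T calm))

cost-calm-≥ : ∀ (T : KeyTree n) Q → Ascending nothing nothing (inorder T) → Calmly nothing nothing T Q →
              totalLength T Q ≤ cost GF Q T
cost-calm-≥ T []      asc calm = z≤n
cost-calm-≥ T (x ∷ Q) asc calm rewrite GF-calm T x Q asc calm | stepCost-unchanged T x =
  ℕ.+-mono-≤ (pathLength≤∣path∣ x T asc) (cost-calm-≥ T Q asc (calmly-tail T calm))

-- Each step touches at most all `n` nodes. This crude bound suffices, since the sequences it is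
-- applied to do not grow with the number of rounds.
cost-serves-≤ : Serves {n} Y nothing nothing 0 T Q T′ → cost GF (Q ++ Y) T ≤ length Q · n + cost GF Y T′
cost-serves-≤ done = ℕ.≤-refl
cost-serves-≤ (skip ¬b _) = ⊥-elim (¬b (Maybe.nothing , Maybe.nothing))
cost-serves-≤ {n = n} {Y = Y} {T = T} {Q = x ∷ Q} (serve _ s) rewrite GF-within T x (Q ++ Y) =
  ℕ.≤-trans (ℕ.+-mono-≤ (∣p∣≤n (path x T ∪ spannedSubtree (rotatedEnds T (GFWithin nothing nothing 0 T x (Q ++ Y))) T))
                        (cost-serves-≤ s))
            (ℕ.≤-reflexive (sym (ℕ.+-assoc n (length Q · n) _)))

cost-serves-≥ : Serves {n} Y nothing nothing 0 T Q T′ → cost GF Y T′ ≤ cost GF (Q ++ Y) T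
cost-serves-≥ done = ℕ.≤-refl
cost-serves-≥ (skip ¬b _) = ⊥-elim (¬b (Maybe.nothing , Maybe.nothing))
cost-serves-≥ {Y = Y} {T = T} {Q = x ∷ Q} (serve _ s) rewrite GF-within T x (Q ++ Y) =
  ℕ.≤-trans (cost-serves-≥ s) (ℕ.m≤n+m _ _)

-- Each query meets the root once and continues in at most one subtree. This turns the path lengths
-- of the recursive trees into recurrences in the height.
totalLength-node : ∀ lo hi {l r : KeyTree n} {v} F → All (Between lo hi) F →
  totalLength (node l v r) F ≡
  length F + (totalLength l (restrict lo (just v) F) + totalLength r (restrict (just v) hi F))
totalLength-node lo hi []      []       = refl
totalLength-node lo hi {l} {r} {v} (x ∷ F) (b ∷ bs) with <-cmp x v
... | tri< x<v _ _
  rewrite filter-accept (between? lo (just v)) {xs = F} (toBelow b x<v)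
        | filter-reject (between? (just v) hi) {xs = F} (y<v⇒y∉above x<v)
        | totalLength-node lo hi {l} {r} {v} F bs
        = arith₁ (pathLength x l) (length F) (totalLength l (restrict lo (just v) F)) (totalLength r (restrict (just v) hi F))
  where
  arith₁ : ∀ p f a b → suc p + (f + (a + b)) ≡ suc f + (p + a + b)
  arith₁ = solve-∀
... | tri≈ _ refl _
  rewrite filter-reject (between? lo (just v)) {xs = F} v∉below
        | filter-reject (between? (just v) hi) {xs = F} v∉above
        = cong suc (totalLength-node lo hi {l} {r} {v} F bs)
... | tri> _ _ v<x
  rewrite filter-reject (between? lo (just v)) {xs = F} (v<y⇒y∉below v<x)
        | filter-accept (between? (just v) hi) {xs = F} (toAbove b v<x)
        | totalLength-node lo hi {l} {r} {v} F bs
        = arith₂ (pathLength x r) (length F) (totalLength l (restrict lo (just v) F)) (totalLength r (restrict (just v) hi F))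
  where
  arith₂ : ∀ p f a b → suc p + (f + (a + b)) ≡ suc f + (a + (p + b))
  arith₂ = solve-∀

-- Shallow and deep trees

data Gadget (n : ℕ) : ℕ → Set where
  leaf : Fin n → Gadget n 0
  node : Gadget n h → (d r e : Fin n) → Gadget n h → Gadget n (suc h)

gadgetKeys : Gadget n h → List (Fin n)
gadgetKeys (leaf k)         = k ∷ []
gadgetKeys (node L d r e R) = gadgetKeys L ++ d ∷ r ∷ e ∷ gadgetKeys R

singleton : Fin n → KeyTree n
singleton k = node (leaf tt) k (leaf tt)

-- `A` and `H` take the places of the outermost leaves. In the shallow tree these places hide the
-- unqueried keys: `d` hangs at the right end of `L` and `e` at the left end of `R`.
shallow deep : Gadget n h → KeyTree n → KeyTree n → KeyTree n
shallow (leaf k)         A H = node A k H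
shallow (node L d r e R) A H = node (shallow L A (singleton d)) r (shallow R (singleton e) H)
deep (leaf k)         A H = node A k H
deep (node L d r e R) A H = node (deep L A (leaf tt)) d (node (singleton r) e (deep R (leaf tt) H))

inorder-shallow : ∀ (g : Gadget n h) A H → inorder (shallow g A H) ≡ inorder A ++ gadgetKeys g ++ inorder H
inorder-shallow (leaf k)         A H = refl
inorder-shallow (node L d r e R) A H = begin
  inorder (shallow L A (singleton d)) ++ r ∷ inorder (shallow R (singleton e) H)
    ≡⟨ cong₂ (λ xs ys → xs ++ r ∷ ys) (inorder-shallow L A (singleton d)) (inorder-shallow R (singleton e) H) ⟩
  (a ++ gadgetKeys L ++ d ∷ []) ++ r ∷ e ∷ gadgetKeys R ++ b  ≡⟨ ++-assoc a (gadgetKeys L ++ d ∷ []) _ ⟩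
  a ++ (gadgetKeys L ++ d ∷ []) ++ r ∷ e ∷ gadgetKeys R ++ b  ≡⟨ cong (a ++_) (++-assoc (gadgetKeys L) (d ∷ []) _) ⟩
  a ++ gadgetKeys L ++ d ∷ r ∷ e ∷ gadgetKeys R ++ b          ≡⟨ cong (a ++_) (++-assoc (gadgetKeys L) (d ∷ r ∷ e ∷ gadgetKeys R) b) ⟨
  a ++ (gadgetKeys L ++ d ∷ r ∷ e ∷ gadgetKeys R) ++ b        ∎
  where
  open ≡-Reasoning
  a = inorder A
  b = inorder H

-- The list is the same as for the shallow tree, so a tour can lead from either tree to the other.
inorder-deep : ∀ (g : Gadget n h) A H → inorder (deep g A H) ≡ inorder A ++ gadgetKeys g ++ inorder H
inorder-deep (leaf k)         A H = refl
inorder-deep (node L d r e R) A H = begin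
  inorder (deep L A (leaf tt)) ++ d ∷ r ∷ e ∷ inorder (deep R (leaf tt) H)
    ≡⟨ cong₂ (λ xs ys → xs ++ d ∷ r ∷ e ∷ ys) (inorder-deep L A (leaf tt)) (inorder-deep R (leaf tt) H) ⟩
  (a ++ gadgetKeys L ++ []) ++ d ∷ r ∷ e ∷ gadgetKeys R ++ b  ≡⟨ cong (λ xs → (a ++ xs) ++ d ∷ r ∷ e ∷ gadgetKeys R ++ b) (++-identityʳ (gadgetKeys L)) ⟩
  (a ++ gadgetKeys L) ++ d ∷ r ∷ e ∷ gadgetKeys R ++ b        ≡⟨ ++-assoc a (gadgetKeys L) _ ⟩
  a ++ gadgetKeys L ++ d ∷ r ∷ e ∷ gadgetKeys R ++ b          ≡⟨ cong (a ++_) (++-assoc (gadgetKeys L) (d ∷ r ∷ e ∷ gadgetKeys R) b) ⟨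
  a ++ (gadgetKeys L ++ d ∷ r ∷ e ∷ gadgetKeys R) ++ b        ∎
  where
  open ≡-Reasoning
  a = inorder A
  b = inorder H

-- The periodic query sequence

alternate : Fin n → List (Fin n) → List (Fin n)
alternate r []       = []
alternate r (y ∷ ys) = r ∷ y ∷ alternate r ys

-- In `queries` both lists have the same length, so the last clause is reached only when both end
-- together.
weave : Fin n → List (Fin n) → List (Fin n) → List (Fin n)
weave r (x ∷ xs) (y ∷ ys) = r ∷ x ∷ y ∷ weave r xs ys
weave r _        _        = []

queries : ℕ → Gadget n h → List (Fin n)
queries N (leaf k)         = replicate N k
queries N (node L d r e R) = weave r (queries N L) (queries N R)

length-alternate : ∀ (r : Fin n) ys → length (alternate r ys) ≡ 2 · length ys
length-alternate r []       = refl
length-alternate r (y ∷ ys) = trans (cong (suc ∘ suc) (length-alternate r ys)) (sym (ℕ.*-suc 2 (length ys)))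

length-weave : ∀ (r : Fin n) xs ys → length xs ≡ length ys → length (weave r xs ys) ≡ 3 · length ys
length-weave r []       []       _  = refl
length-weave r (x ∷ xs) (y ∷ ys) eq =
  trans (cong (suc ∘ suc ∘ suc) (length-weave r xs ys (ℕ.suc-injective eq))) (sym (ℕ.*-suc 3 (length ys)))

length-queries : ∀ N (g : Gadget n h) → length (queries N g) ≡ N · 3 ^ h
length-queries N (leaf k) = trans (length-replicate N) (sym (ℕ.*-identityʳ N))
length-queries {h = suc h} N (node L d r e R) = begin
  length (weave r (queries N L) (queries N R))  ≡⟨ length-weave r (queries N L) (queries N R) (trans (length-queries N L) (sym (length-queries N R))) ⟩
  3 · length (queries N R)                      ≡⟨ cong (3 ·_) (length-queries N R) ⟩
  3 · (N · 3 ^ h)                               ≡⟨ shuffle N (3 ^ h) ⟩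
  N · (3 · 3 ^ h)                               ∎
  where
  open ≡-Reasoning
  shuffle : ∀ a b → 3 · (a · b) ≡ a · (3 · b)
  shuffle = solve-∀

weave-All : ∀ {P : Fin n → Set} {r} → P r → All P xs → All P ys → All P (weave r xs ys)
weave-All p []       _        = []
weave-All p (_ ∷ _)  []       = []
weave-All p (q ∷ qs) (s ∷ ss) = p ∷ q ∷ s ∷ weave-All p qs ss

queries-All : ∀ {P : Fin n → Set} N (g : Gadget n h) → All P (gadgetKeys g) → All P (queries N g)
queries-All N (leaf k) (p ∷ []) = All.replicate⁺ N p
queries-All N (node L d r e R) ps with All.++⁻ʳ (gadgetKeys L) ps
... | _ ∷ p ∷ _ ∷ qs = weave-All p (queries-All N L (All.++⁻ˡ (gadgetKeys L) ps)) (queries-All N R qs)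

linked-weave : ∀ {R : Fin n → Fin n → Set} {r} {P Q : Fin n → Set} →
               (∀ {x} → P x → R r x) → (∀ {x y} → P x → Q y → R x y) → (∀ {y} → Q y → R y r) →
               All P xs → All Q ys → Linked R (weave r xs ys)
linked-weave f g k []       _        = []
linked-weave f g k (_ ∷ _)  []       = []
linked-weave {xs = _ ∷ []}     f g k (p ∷ ps)      (q ∷ qs)     = f p ∷ g p q ∷ [-]
linked-weave {xs = _ ∷ _ ∷ _} {ys = _ ∷ []} f g k (p ∷ ps)      (q ∷ qs)     = f p ∷ g p q ∷ [-]
linked-weave {xs = _ ∷ _ ∷ _} {ys = _ ∷ _ ∷ _} f g k (p ∷ ps) (q ∷ qs) = f p ∷ g p q ∷ k q ∷ linked-weave f g k ps qs

linked-alternate : ∀ {R : Fin n → Fin n → Set} {r} {Q : Fin n → Set} →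
                   (∀ {y} → Q y → R r y) → (∀ {y} → Q y → R y r) → All Q ys → Linked R (alternate r ys)
linked-alternate f k []               = []
linked-alternate f k (q ∷ [])         = f q ∷ [-]
linked-alternate f k (q ∷ qs@(_ ∷ _)) = f q ∷ k q ∷ linked-alternate f k qs

restrict-weave-left : ∀ lo hi {r : Fin n} {xs ys} → ¬ Between lo hi r → All (Between lo hi) xs →
  All (¬_ ∘ Between lo hi) ys → length xs ≡ length ys → restrict lo hi (weave r xs ys) ≡ xs
restrict-weave-left lo hi ¬r []       []       _  = refl
restrict-weave-left lo hi {r} {x ∷ xs} {y ∷ ys} ¬r (b ∷ bs) (c ∷ cs) eq
  rewrite filter-reject (between? lo hi) {xs = x ∷ y ∷ weave r xs ys} ¬r
        | filter-accept (between? lo hi) {xs = y ∷ weave r xs ys} b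
        | filter-reject (between? lo hi) {xs = weave r xs ys} c
        = cong (x ∷_) (restrict-weave-left lo hi ¬r bs cs (ℕ.suc-injective eq))

restrict-weave-right : ∀ lo hi {r : Fin n} {xs ys} → ¬ Between lo hi r → All (¬_ ∘ Between lo hi) xs →
  All (Between lo hi) ys → length xs ≡ length ys → restrict lo hi (weave r xs ys) ≡ ys
restrict-weave-right lo hi ¬r []       []       _  = refl
restrict-weave-right lo hi {r} {x ∷ xs} {y ∷ ys} ¬r (b ∷ bs) (c ∷ cs) eq
  rewrite filter-reject (between? lo hi) {xs = x ∷ y ∷ weave r xs ys} ¬r
        | filter-reject (between? lo hi) {xs = y ∷ weave r xs ys} b
        | filter-accept (between? lo hi) {xs = weave r xs ys} c
        = cong (y ∷_) (restrict-weave-right lo hi ¬r bs cs (ℕ.suc-injective eq))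

-- This is the sequence seen by `e`, the right child of `d` in the deep tree: the cycle without the
-- queries to `L`.
restrict-weave-alternate : ∀ lo hi {r : Fin n} {xs ys} → Between lo hi r → All (¬_ ∘ Between lo hi) xs →
  All (Between lo hi) ys → length xs ≡ length ys → restrict lo hi (weave r xs ys) ≡ alternate r ys
restrict-weave-alternate lo hi br []       []       _  = refl
restrict-weave-alternate lo hi {r} {x ∷ xs} {y ∷ ys} br (b ∷ bs) (c ∷ cs) eq
  rewrite filter-accept (between? lo hi) {xs = x ∷ y ∷ weave r xs ys} br
        | filter-reject (between? lo hi) {xs = y ∷ weave r xs ys} b
        | filter-accept (between? lo hi) {xs = weave r xs ys} c
        = cong (λ zs → r ∷ y ∷ zs) (restrict-weave-alternate lo hi br bs cs (ℕ.suc-injective eq))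

restrict-alternate-left : ∀ lo hi {r : Fin n} {ys} → Between lo hi r → All (¬_ ∘ Between lo hi) ys →
  restrict lo hi (alternate r ys) ≡ replicate (length ys) r
restrict-alternate-left lo hi br [] = refl
restrict-alternate-left lo hi {r} {y ∷ ys} br (c ∷ cs)
  rewrite filter-accept (between? lo hi) {xs = y ∷ alternate r ys} br
        | filter-reject (between? lo hi) {xs = alternate r ys} c
        = cong (r ∷_) (restrict-alternate-left lo hi br cs)

restrict-alternate-right : ∀ lo hi {r : Fin n} {ys} → ¬ Between lo hi r → All (Between lo hi) ys →
  restrict lo hi (alternate r ys) ≡ ys
restrict-alternate-right lo hi ¬r [] = refl
restrict-alternate-right lo hi {r} {y ∷ ys} ¬r (c ∷ cs)
  rewrite filter-reject (between? lo hi) {xs = y ∷ alternate r ys} ¬r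
        | filter-accept (between? lo hi) {xs = alternate r ys} c
        = cong (y ∷_) (restrict-alternate-right lo hi ¬r cs)

-- Stability of the two trees under the periodic queries

queries-shallow : ∀ {P : Fin n → Set} N (g : Gadget n h) A H → All P (inorder (shallow g A H)) → All P (queries N g)
queries-shallow N g A H ps =
  queries-All N g (All.++⁻ˡ (gadgetKeys g) (All.++⁻ʳ (inorder A) (subst (All _) (inorder-shallow g A H) ps)))

queries-deep : ∀ {P : Fin n → Set} N (g : Gadget n h) A H → All P (inorder (deep g A H)) → All P (queries N g)
queries-deep N g A H ps =
  queries-All N g (All.++⁻ˡ (gadgetKeys g) (All.++⁻ʳ (inorder A) (subst (All _) (inorder-deep g A H) ps)))

length-≡ : ∀ N (g g′ : Gadget n h) → length (queries N g) ≡ length (queries N g′)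
length-≡ N g g′ = trans (length-queries N g) (sym (length-queries N g′))

calmly-leaf : ∀ N lo hi {k : Fin n} A H → Calmly lo hi (node A k H) (replicate N k)
calmly-leaf N lo hi {k} A H =
  repeated N ,
  subst (Calmly lo (just k) A) (sym (filter-none (between? lo (just k)) (All.replicate⁺ N v∉below))) (calmly-[] lo (just k) A) ,
  subst (Calmly (just k) hi H) (sym (filter-none (between? (just k) hi) (All.replicate⁺ N v∉above))) (calmly-[] (just k) hi H)
  where
  repeated : ∀ N → Linked (Calm A k H) (replicate N k)
  repeated 0             = []
  repeated 1             = [-]
  repeated (suc (suc N)) = calm-root {l = A} {r = H} ∷ repeated (suc N)

-- A query to `r` touches only the root; a query in `L` is followed by one in `R`, across the root;
-- a query in `R` is followed by the root itself. Never does another path key separate `r` from the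
-- next query.
shallow-calm : ∀ N (g : Gadget n h) A H → Ascending lo hi (inorder (shallow g A H)) →
               Calmly lo hi (shallow g A H) (queries N g)
shallow-calm {lo = lo} {hi = hi} N (leaf k) A H asc = calmly-leaf N lo hi A H
shallow-calm {lo = lo} {hi = hi} N (node L d r e R) A H asc
  with ascending-split lo (inorder (shallow L A (singleton d))) asc
... | al , _ , ar =
  linked-weave (λ _ → calm-root {l = Lt} {r = Rt})
    (λ x y → calm-rightwards {l = Lt} {r = Rt} (All.map below< bl) (below< x) (above> y))
    (λ y → calm-return {r = Rt} {l = Lt} (All.map above> br) (above> y)) qL qR ,
  subst (Calmly lo (just r) Lt) (sym (restrict-weave-left lo (just r) v∉below qL
    (All.map (v<y⇒y∉below ∘ above>) qR) (length-≡ N L R))) (shallow-calm N L A (singleton d) al) ,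
  subst (Calmly (just r) hi Rt) (sym (restrict-weave-right (just r) hi v∉above
    (All.map (y<v⇒y∉above ∘ below<) qL) qR (length-≡ N L R))) (shallow-calm N R (singleton e) H ar)
  where
  Lt = shallow L A (singleton d)
  Rt = shallow R (singleton e) H
  bl = ascending⇒between lo (inorder Lt) al
  br = ascending⇒between (just r) (inorder Rt) ar
  qL = queries-shallow N L A (singleton d) bl
  qR = queries-shallow N R (singleton e) H br

-- As `y` lies beyond `e`, its path below `d` consists of `e` and larger keys, while `r` lies
-- between `d` and `e`. Both `d` and `e` then wait for `r`, and the tie goes to the shallower `d`.
calm-gap : ∀ {d r e : Fin n} {l M R} → All (e <_) (inorder R) → d < y → e < y → r < e → Calm l d (node M e R) y r
calm-gap {y = y} {e = e} {R = R} eR d<y e<y r<e δ = (λ y<d → ⊥-elim (<-asym y<d d<y)) , λ _ → beyond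
  where
  beyond : All (λ h → _ < proj₁ h) (proj₂ (decompose y δ (node _ e R)))
  beyond with <-cmp y e
  ... | tri< y<e _ _  = ⊥-elim (<-asym y<e e<y)
  ... | tri≈ _ refl _ = ⊥-elim (<-irrefl refl e<y)
  ... | tri> _ _ _    = r<e ∷ All.map (<-trans r<e) (decompose-keys y (suc δ) R eR)

calmly-singleton : ∀ lo hi (k : Fin n) F → Calmly lo hi (singleton k) F
calmly-singleton lo hi k F = linked F , tt , tt
  where
  linked : ∀ F → Linked (Calm (leaf tt) k (leaf tt)) F
  linked []          = []
  linked (_ ∷ [])    = [-]
  linked (_ ∷ _ ∷ F) = (λ _ → (λ _ → []) , (λ _ → [])) ∷ linked (_ ∷ F)

-- Around `d` the cycle jumps left from `r` to `L`, right from `L` to `R`, and then back into the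
-- gap between `d` and `e`. Around `e` it alternates between `r` on the left and `R` on the right.
deep-calm : ∀ N (g : Gadget n h) A H → Ascending lo hi (inorder (deep g A H)) →
            Calmly lo hi (deep g A H) (queries N g)
deep-calm {lo = lo} {hi = hi} N (leaf k) A H asc = calmly-leaf N lo hi A H
deep-calm {lo = lo} {hi = hi} N (node L d r e R) A H asc
  with ascending-split lo (inorder (deep L A (leaf tt))) asc
... | al , _ , ar@(dr , re , aR) =
  linked-weave
    (λ x → calm-leftwards {r = Rn} {l = Lt} (All.map above> bn) (above> dr) (below< x))
    (λ x y → calm-rightwards {l = Lt} {r = Rn} (All.map below< bl) (below< x) (<-trans (<-trans (above> dr) (above> re)) (above> y)))
    (λ y → calm-gap {l = Lt} {M = singleton r} (All.map above> bR) (<-trans (<-trans (above> dr) (above> re)) (above> y)) (above> y) (above> re))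
    qL qR ,
  subst (Calmly lo (just d) Lt) (sym (restrict-weave-left lo (just d) (y∉below-r) qL
    (All.map (λ y → v<y⇒y∉below (<-trans (<-trans (above> dr) (above> re)) (above> y))) qR) (length-≡ N L R)))
    (deep-calm N L A (leaf tt) al) ,
  subst (Calmly (just d) hi Rn) (sym (restrict-weave-alternate (just d) hi dr (All.map (y<v⇒y∉above ∘ below<) qL)
    (All.map (above-⊑ dr ∘ above-⊑ re) qR) (length-≡ N L R)))
    ( linked-alternate
        (λ y → calm-rightwards {l = singleton r} {r = Rt} (above> re ∷ []) (above> re) (above> y))
        (λ y → calm-leftwards {r = Rt} {l = singleton r} (All.map above> bR) (above> y) (above> re)) qR
    , calmly-singleton (just d) (just e) r _
    , subst (Calmly (just e) hi Rt) (sym (restrict-alternate-right (just e) hi (y<v⇒y∉above (above> re)) qR))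
        (deep-calm N R (leaf tt) H aR))
  where
  Lt = deep L A (leaf tt)
  Rt = deep R (leaf tt) H
  Rn = node (singleton r) e Rt
  bl = ascending⇒between lo (inorder Lt) al
  bn = ascending⇒between (just d) (inorder Rn) ar
  bR = ascending⇒between (just e) (inorder Rt) aR
  qL = queries-deep N L A (leaf tt) bl
  qR = queries-deep N R (leaf tt) H bR
  y∉below-r = v<y⇒y∉below (above> dr)

-- Total path lengths in the two trees

totalLength-root : ∀ N {k : Fin n} A H → totalLength (node A k H) (replicate N k) ≡ N
totalLength-root zero A H = refl
totalLength-root (suc N) {k} A H with totalLength-root N {k} A H | <-cmp k k
... | ih | tri< k<k _ _ = ⊥-elim (<-irrefl refl k<k)
... | ih | tri≈ _ _ _   = cong suc ih
... | ih | tri> _ _ k<k = ⊥-elim (<-irrefl refl k<k)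

alternate-All : ∀ {P : Fin n → Set} {r} → P r → All P ys → All P (alternate r ys)
alternate-All p []       = []
alternate-All p (q ∷ qs) = p ∷ q ∷ alternate-All p qs

-- The recurrence is s(h+1) = N·3^(h+1) + 2·s(h) with s(0) = N. The negative term of its solution
-- stands on the left to avoid subtraction.
totalLength-shallow : ∀ N (g : Gadget n h) A H → Ascending lo hi (inorder (shallow g A H)) →
                      totalLength (shallow g A H) (queries N g) + 2 · (N · 2 ^ h) ≡ 3 · (N · 3 ^ h)
totalLength-shallow N (leaf k) A H asc rewrite totalLength-root N {k} A H = base N
  where
  base : ∀ N → N + 2 · (N · 1) ≡ 3 · (N · 1)
  base = solve-∀
totalLength-shallow {h = suc h} {lo = lo} {hi = hi} N g@(node L d r e R) A H asc
  with ascending-split lo (inorder (shallow L A (singleton d))) asc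
... | al , _ , ar = begin
  totalLength (node Lt r Rt) qs + 2 · (N · 2 ^ suc h)
    ≡⟨ cong (_+ 2 · (N · 2 ^ suc h)) (totalLength-node lo hi qs
         (queries-shallow N g A H (ascending⇒between lo (inorder (shallow g A H)) asc))) ⟩
  length qs + (totalLength Lt (restrict lo (just r) qs) + totalLength Rt (restrict (just r) hi qs)) + 2 · (N · 2 ^ suc h)
    ≡⟨ cong₂ (λ m s → m + s + 2 · (N · 2 ^ suc h)) (length-queries N g) (cong₂ _+_
         (cong (totalLength Lt) (restrict-weave-left lo (just r) v∉below qL (All.map (v<y⇒y∉below ∘ above>) qR) (length-≡ N L R)))
         (cong (totalLength Rt) (restrict-weave-right (just r) hi v∉above (All.map (y<v⇒y∉above ∘ below<) qL) qR (length-≡ N L R)))) ⟩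
  N · 3 ^ suc h + (tL + tR) + 2 · (N · 2 ^ suc h)
    ≡⟨ regroup N (2 ^ h) (3 ^ h) tL tR ⟩
  N · 3 ^ suc h + ((tL + 2 · (N · 2 ^ h)) + (tR + 2 · (N · 2 ^ h)))
    ≡⟨ cong (λ z → N · 3 ^ suc h + z) (cong₂ _+_ (totalLength-shallow N L A (singleton d) al) (totalLength-shallow N R (singleton e) H ar)) ⟩
  N · 3 ^ suc h + (3 · (N · 3 ^ h) + 3 · (N · 3 ^ h))
    ≡⟨ collect N (3 ^ h) ⟩
  3 · (N · 3 ^ suc h) ∎
  where
  open ≡-Reasoning
  qs  = queries N g
  Lt = shallow L A (singleton d)
  Rt = shallow R (singleton e) H
  qL = queries-shallow N L A (singleton d) (ascending⇒between lo (inorder Lt) al)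
  qR = queries-shallow N R (singleton e) H (ascending⇒between (just r) (inorder Rt) ar)
  tL = totalLength Lt (queries N L)
  tR = totalLength Rt (queries N R)
  regroup : ∀ N a m s t → N · (3 · m) + (s + t) + 2 · (N · (2 · a)) ≡ N · (3 · m) + ((s + 2 · (N · a)) + (t + 2 · (N · a)))
  regroup = solve-∀
  collect : ∀ N m → N · (3 · m) + (3 · (N · m) + 3 · (N · m)) ≡ 3 · (N · (3 · m))
  collect = solve-∀

-- The recurrence is t(h+1) = 6·N·3^h + 2·t(h) with t(0) = N: of the six units three are visits to
-- `d`, two to `e` and one to `r`. The leading coefficient 6 is twice that of the shallow tree.
totalLength-deep : ∀ N (g : Gadget n h) A H → Ascending lo hi (inorder (deep g A H)) →
                   totalLength (deep g A H) (queries N g) + 5 · (N · 2 ^ h) ≡ 6 · (N · 3 ^ h)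
totalLength-deep N (leaf k) A H asc rewrite totalLength-root N {k} A H = base N
  where
  base : ∀ N → N + 5 · (N · 1) ≡ 6 · (N · 1)
  base = solve-∀
totalLength-deep {h = suc h} {lo = lo} {hi = hi} N g@(node L d r e R) A H asc
  with ascending-split lo (inorder (deep L A (leaf tt))) asc
... | al , _ , dr , re , aR = begin
  totalLength (node Lt d Rn) qs + 5 · (N · 2 ^ suc h)
    ≡⟨ cong (_+ 5 · (N · 2 ^ suc h)) (totalLength-node lo hi qs
         (queries-deep N g A H (ascending⇒between lo (inorder (deep g A H)) asc))) ⟩
  length qs + (totalLength Lt (restrict lo (just d) qs) + totalLength Rn (restrict (just d) hi qs)) + 5 · (N · 2 ^ suc h)
    ≡⟨ cong₂ (λ m s → m + s + 5 · (N · 2 ^ suc h)) (length-queries N g) (cong₂ _+_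
         (cong (totalLength Lt) (restrict-weave-left lo (just d) (v<y⇒y∉below (above> dr)) qL
           (All.map (v<y⇒y∉below ∘ above>) qR′) (length-≡ N L R)))
         rightPart) ⟩
  N · 3 ^ suc h + (tL + (2 · (N · 3 ^ h) + (N · 3 ^ h + tR))) + 5 · (N · 2 ^ suc h)
    ≡⟨ regroup N (2 ^ h) (3 ^ h) tL tR ⟩
  6 · (N · 3 ^ h) + ((tL + 5 · (N · 2 ^ h)) + (tR + 5 · (N · 2 ^ h)))
    ≡⟨ cong (λ z → 6 · (N · 3 ^ h) + z) (cong₂ _+_ (totalLength-deep N L A (leaf tt) al) (totalLength-deep N R (leaf tt) H aR)) ⟩
  6 · (N · 3 ^ h) + (6 · (N · 3 ^ h) + 6 · (N · 3 ^ h))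
    ≡⟨ collect N (3 ^ h) ⟩
  6 · (N · 3 ^ suc h) ∎
  where
  open ≡-Reasoning
  qs  = queries N g
  Lt = deep L A (leaf tt)
  Rt = deep R (leaf tt) H
  Rn = node (singleton r) e Rt
  qs′ = alternate r (queries N R)
  qL = queries-deep N L A (leaf tt) (ascending⇒between lo (inorder Lt) al)
  qR = queries-deep N R (leaf tt) H (ascending⇒between (just e) (inorder Rt) aR)
  qR′ = All.map (above-⊑ dr ∘ above-⊑ re) qR
  tL = totalLength Lt (queries N L)
  tR = totalLength Rt (queries N R)
  rightPart : totalLength Rn (restrict (just d) hi qs) ≡ 2 · (N · 3 ^ h) + (N · 3 ^ h + tR)
  rightPart = begin
    totalLength Rn (restrict (just d) hi qs)
      ≡⟨ cong (totalLength Rn) (restrict-weave-alternate (just d) hi dr (All.map (y<v⇒y∉above ∘ below<) qL) qR′ (length-≡ N L R)) ⟩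
    totalLength Rn qs′
      ≡⟨ totalLength-node (just d) hi qs′ (alternate-All dr qR′) ⟩
    length qs′ + (totalLength (singleton r) (restrict (just d) (just e) qs′) + totalLength Rt (restrict (just e) hi qs′))
      ≡⟨ cong₂ _+_ (trans (length-alternate r (queries N R)) (cong (2 ·_) (length-queries N R))) (cong₂ _+_
           (trans (cong (totalLength (singleton r)) (restrict-alternate-left (just d) (just e) (toBelow dr (above> re))
                    (All.map (v<y⇒y∉below ∘ above>) qR)))
                  (trans (totalLength-root (length (queries N R)) {r} (leaf tt) (leaf tt)) (length-queries N R)))
           (cong (totalLength Rt) (restrict-alternate-right (just e) hi (y<v⇒y∉above (above> re)) qR))) ⟩
    2 · (N · 3 ^ h) + (N · 3 ^ h + tR) ∎
  regroup : ∀ N a m s t → N · (3 · m) + (s + (2 · (N · m) + (N · m + t))) + 5 · (N · (2 · a)) ≡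
                          6 · (N · m) + ((s + 5 · (N · a)) + (t + 5 · (N · a)))
  regroup = solve-∀
  collect : ∀ N m → 6 · (N · m) + (6 · (N · m) + 6 · (N · m)) ≡ 6 · (N · (3 · m))
  collect = solve-∀

-- Placing both trees on the keys of the initial tree

gadgetSize : ℕ → ℕ
gadgetSize zero    = 1
gadgetSize (suc h) = gadgetSize h + (3 + gadgetSize h)

-- `m` counts the keys to be left over. The call for `L` reserves the three middle keys, the keys of
-- `R` and the original `m`.
cutGadget : ∀ h m (ks : List (Fin n)) → gadgetSize h + m ≤ length ks →
            Σ[ g ∈ Gadget n h ] Σ[ rest ∈ List (Fin n) ] (ks ≡ gadgetKeys g ++ rest) × (m ≤ length rest)
cutGadget zero    m (k ∷ ks) (s≤s m≤) = leaf k , ks , refl , m≤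
cutGadget (suc h) m ks       size≤
  with cutGadget h (3 + (gadgetSize h + m)) ks (subst (_≤ length ks) (ℕ.+-assoc (gadgetSize h) (3 + gadgetSize h) m) size≤)
... | L , d ∷ r ∷ e ∷ ks′ , refl , s≤s (s≤s (s≤s size≤′)) with cutGadget h m ks′ size≤′
...   | R , rest , refl , m≤ = node L d r e R , rest , sym (++-assoc (gadgetKeys L) (d ∷ r ∷ e ∷ gadgetKeys R) rest) , m≤

-- Holds the surplus keys, hung at the right end of both trees.
spine : List (Fin n) → KeyTree n
spine []       = leaf tt
spine (k ∷ ks) = node (leaf tt) k (spine ks)

inorder-spine : ∀ (ks : List (Fin n)) → inorder (spine ks) ≡ ks
inorder-spine []       = refl
inorder-spine (k ∷ ks) = cong (k ∷_) (inorder-spine ks)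

searchTree⇒ascending : ∀ {T : KeyTree n} → SearchTree T → AllKeys (Between lo hi) T → Ascending lo hi (inorder T)
searchTree⇒ascending leaf _ = tt
searchTree⇒ascending {lo = lo} (node {l} l<k k<r sl sr) (Tree.node bl bk br) =
  ascending-join lo (inorder l) (searchTree⇒ascending sl (zipAll toBelow bl l<k)) bk
                 (searchTree⇒ascending sr (zipAll toAbove br k<r))
  where
  zipAll : ∀ {P Q R : Fin _ → Set} {T} → (∀ {y} → P y → Q y → R y) → AllKeys P T → AllKeys Q T → AllKeys R T
  zipAll f (Tree.leaf _)     (Tree.leaf _)     = Tree.leaf _
  zipAll f (Tree.node a b c) (Tree.node d e g) = Tree.node (zipAll f a d) (f b e) (zipAll f c g)

everything : ∀ (T : KeyTree n) → AllKeys (Between nothing nothing) T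
everything (leaf _)     = Tree.leaf _
everything (node l k r) = Tree.node (everything l) (Maybe.nothing , Maybe.nothing) (everything r)

∣keys∣≤length : ∀ (T : KeyTree n) → ∣ keys T ∣ ≤ length (inorder T)
∣keys∣≤length {n} (leaf _) = ℕ.≤-reflexive (∣⊥∣≡0 n)
∣keys∣≤length (node l k r) = begin
  ∣ ⁅ k ⁆ ∪ keys l ∪ keys r ∣                        ≤⟨ ∣⁅k⁆∪p∣≤1+∣p∣ k (keys l ∪ keys r) ⟩
  suc ∣ keys l ∪ keys r ∣                            ≤⟨ s≤s (∣p∪q∣≤∣p∣+∣q∣ (keys l) (keys r)) ⟩
  suc (∣ keys l ∣ + ∣ keys r ∣)                      ≤⟨ s≤s (ℕ.+-mono-≤ (∣keys∣≤length l) (∣keys∣≤length r)) ⟩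
  suc (length (inorder l) + length (inorder r))      ≡⟨ ℕ.+-suc (length (inorder l)) (length (inorder r)) ⟨
  length (inorder l) + suc (length (inorder r))      ≡⟨ length-++ (inorder l) ⟨
  length (inorder l ++ k ∷ inorder r)                ∎
  where open ℕ.≤-Reasoning

n≤length : ∀ {T : KeyTree n} → IsBST T → n ≤ length (inorder T)
n≤length {n} {T} bst = begin
  n                     ≡⟨ ∣⊤∣≡n n ⟨
  ∣ ⊤ {n} ∣             ≤⟨ p⊆q⇒∣p∣≤∣q∣ {p = ⊤} {q = keys T} (λ {k} _ → IsBST.complete bst k) ⟩
  ∣ keys T ∣            ≤⟨ ∣keys∣≤length T ⟩
  length (inorder T)    ∎
  where open ℕ.≤-Reasoning

-- Arithmetic of the cost ratio

-- Bernoulli's inequality for 3/2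
2^h*[2+h]≤2*3^h : ∀ h → 2 ^ h · (2 + h) ≤ 2 · 3 ^ h
2^h*[2+h]≤2*3^h zero    = ℕ.≤-refl
2^h*[2+h]≤2*3^h (suc h) = begin
  2 · 2 ^ h · (3 + h)          ≤⟨ ℕ.m≤m+n _ (2 ^ h · h) ⟩
  2 · 2 ^ h · (3 + h) + 2 ^ h · h ≡⟨ regroup (2 ^ h) h ⟩
  3 · (2 ^ h · (2 + h))        ≤⟨ ℕ.*-monoʳ-≤ 3 (2^h*[2+h]≤2*3^h h) ⟩
  3 · (2 · 3 ^ h)              ≡⟨ swap (3 ^ h) ⟩
  2 · (3 · 3 ^ h)              ∎
  where
  open ℕ.≤-Reasoning
  regroup : ∀ a h → 2 · a · (3 + h) + a · h ≡ 3 · (a · (2 + h))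
  regroup = solve-∀
  swap : ∀ m → 3 · (2 · m) ≡ 2 · (3 · m)
  swap = solve-∀

-- The prefix cost K is absorbed by the N rounds, since N > 2K.
ratio : ∀ q K {a b s t} → let den = suc q ; N = suc (2 · K) ; height = 2 · den in
        s + 2 · (N · 2 ^ height) ≡ 3 · (N · 3 ^ height) → t + 5 · (N · 2 ^ height) ≡ 6 · (N · 3 ^ height) →
        b ≤ K + s → t ≤ a → suc (2 · q) · b ≤ den · a
ratio q K {a} {b} {s} {t} shallow-cost deep-cost b≤ t≤a = ℕ.+-cancelʳ-≤ _ _ _ (begin
  -- The target ratio `c` / `den` is 2 - 1/`den`. The term added on both sides lets the two cost
  -- identities apply without subtraction.
  c · b + (2 · c · M₂ + 5 · den · M₂)                ≤⟨ ℕ.+-monoˡ-≤ _ (ℕ.*-monoʳ-≤ c b≤) ⟩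
  c · (K + s) + (2 · c · M₂ + 5 · den · M₂)          ≡⟨ e₁ q K s M₂ ⟩
  c · (s + 2 · M₂) + (c · K + 5 · den · M₂)          ≡⟨ cong (λ z → c · z + (c · K + 5 · den · M₂)) shallow-cost ⟩
  c · (3 · M₃) + (c · K + 5 · den · M₂)              ≡⟨ e₂ q K M₂ M₃ ⟩
  -- The coefficient of `M₂` has been split by 5·`den` = (3 + q) + 2·`c`. The slack for `main` is
  -- 3·`M₃`, because 6·`den` - 3·`c` = 3.
  c · (3 · M₃) + (c · K + (3 + q) · M₂) + 2 · c · M₂ ≤⟨ ℕ.+-monoˡ-≤ _ (ℕ.+-monoʳ-≤ (c · (3 · M₃)) main) ⟩
  c · (3 · M₃) + 3 · M₃ + 2 · c · M₂               ≡⟨ e₃ q M₂ M₃ ⟩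
  den · (6 · M₃) + 2 · c · M₂                        ≡⟨ cong (λ z → den · z + 2 · c · M₂) deep-cost ⟨
  den · (t + 5 · M₂) + 2 · c · M₂                    ≡⟨ e₄ q t M₂ ⟩
  den · t + (2 · c · M₂ + 5 · den · M₂)                ≤⟨ ℕ.+-monoˡ-≤ _ (ℕ.*-monoʳ-≤ den t≤a) ⟩
  den · a + (2 · c · M₂ + 5 · den · M₂)                ∎)
  where
  open ℕ.≤-Reasoning
  den = suc q
  N = suc (2 · K)
  -- With this height Bernoulli's inequality gives (3/2)^height ≥ 1 + `den`.
  height = 2 · den
  c = suc (2 · q)
  M₂ = N · 2 ^ height
  M₃ = N · 3 ^ height
  e₁ : ∀ q K s m → suc (2 · q) · (K + s) + (2 · suc (2 · q) · m + 5 · suc q · m) ≡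
                   suc (2 · q) · (s + 2 · m) + (suc (2 · q) · K + 5 · suc q · m)
  e₁ = solve-∀
  e₂ : ∀ q K m p → suc (2 · q) · (3 · p) + (suc (2 · q) · K + 5 · suc q · m) ≡
                   suc (2 · q) · (3 · p) + (suc (2 · q) · K + (3 + q) · m) + 2 · suc (2 · q) · m
  e₂ = solve-∀
  e₃ : ∀ q m p → suc (2 · q) · (3 · p) + 3 · p + 2 · suc (2 · q) · m ≡ suc q · (6 · p) + 2 · suc (2 · q) · m
  e₃ = solve-∀
  e₄ : ∀ q t m → suc q · (t + 5 · m) + 2 · suc (2 · q) · m ≡ suc q · t + (2 · suc (2 · q) · m + 5 · suc q · m)
  e₄ = solve-∀
  power : 2 ^ height · (1 + den) ≤ 3 ^ height
  power = ℕ.*-cancelˡ-≤ 2 (begin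
    2 · (2 ^ height · (1 + den))  ≡⟨ double (2 ^ height) den ⟩
    2 ^ height · (2 + height)        ≤⟨ 2^h*[2+h]≤2*3^h height ⟩
    2 · 3 ^ height              ∎)
    where
    double : ∀ a q → 2 · (a · (1 + q)) ≡ a · (2 + 2 · q)
    double = solve-∀
  main : c · K + (3 + q) · M₂ ≤ 3 · M₃
  main = begin
    -- Rounding `c` up to 3 + 2q makes the total coefficient 6 + 3q, which is 3·(1 + `den`).
    c · K + (3 + q) · M₂                   ≤⟨ ℕ.+-monoˡ-≤ _ (ℕ.*-mono-≤ {c} {3 + 2 · q} (ℕ.m≤n+m c 2) K≤M₂) ⟩
    (3 + 2 · q) · M₂ + (3 + q) · M₂        ≡⟨ factor q N (2 ^ height) ⟩
    3 · (N · (2 ^ height · (1 + den)))            ≤⟨ ℕ.*-monoʳ-≤ 3 (ℕ.*-monoʳ-≤ N power) ⟩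
    3 · M₃                                 ∎
    where
    K≤M₂ : K ≤ M₂
    K≤M₂ = ℕ.≤-trans (ℕ.≤-trans (ℕ.m≤m+n K (K + 0)) (ℕ.n≤1+n (2 · K))) (ℕ.m≤m*n N (2 ^ height) {{ℕ.m^n≢0 2 height}})
    factor : ∀ q N a → (3 + 2 · q) · (N · a) + (3 + q) · (N · a) ≡ 3 · (N · (a · (1 + suc q)))
    factor = solve-∀

toℚᵘ-/1 : ∀ a → toℚᵘ (+ a / 1) ℚᵘ.≃ mkℚᵘ (+ a) 0
toℚᵘ-/1 a = ℚ.toℚᵘ-fromℚᵘ (mkℚᵘ (+ a) 0)

-- A positive ε with denominator `suc q` is at least 1/`suc q`, so 2 - ε is at most (2q + 1)/(q +
-- 1). The comparison is made with unnormalised fractions, where it becomes an inequality of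
-- integers.
ratioℚ : ∀ ε → ε > 0ℚ → ∀ {a b} → let q = ℚ.ℚ.denominator-1 ε in
         suc (2 · q) · b ≤ suc q · a → + a / 1 ≥ (+ 2 / 1 - ε) * (+ b / 1)
ratioℚ ε@(mkℚ +[1+ k ] q _) _ {a} {b} le = ℚ.toℚᵘ-cancel-≤ (begin
  toℚᵘ ((+ 2 / 1 - ε) * (+ b / 1))                           ≃⟨ ℚ.toℚᵘ-homo-* (+ 2 / 1 - ε) (+ b / 1) ⟩
  toℚᵘ (+ 2 / 1 - ε) ℚᵘ.* toℚᵘ (+ b / 1)                      ≃⟨ ℚᵘ.*-cong (ℚ.toℚᵘ-homo-+ (+ 2 / 1) (ℚ.- ε)) (toℚᵘ-/1 b) ⟩
  (mkℚᵘ (+ 2) 0 ℚᵘ.- mkℚᵘ +[1+ k ] q) ℚᵘ.* mkℚᵘ (+ b) 0       ≤⟨ *≤* integral ⟩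
  mkℚᵘ (+ a) 0                                                ≃⟨ toℚᵘ-/1 a ⟨
  toℚᵘ (+ a / 1)                                              ∎)
  where
  open ℚᵘ.≤-Reasoning
  natural : 2 · suc q · b ≤ suc q · a + suc k · b
  natural = ℕ.≤-trans (ℕ.≤-reflexive (regroup q b)) (ℕ.+-mono-≤ le (ℕ.m≤m+n b (k · b)))
    where
    regroup : ∀ q b → 2 · suc q · b ≡ suc (2 · q) · b + b
    regroup = solve-∀
  products : ∀ m o p → + (m · o) ℤ.+ + (p · b) ≡ (+ m ℤ.* + o) ℤ.+ (+ p ℤ.* + b)
  products m o p = cong₂ ℤ._+_ (ℤ.pos-* m o) (ℤ.pos-* p b)
  integral : ((+ 2 ℤ.* + suc q ℤ.+ (ℤ.- +[1+ k ]) ℤ.* + 1) ℤ.* + b) ℤ.* + 1 ℤ.≤ + a ℤ.* + (1 · suc q · 1)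
  integral = ℤ-≤.begin
    ((+ 2 ℤ.* + suc q ℤ.+ (ℤ.- +[1+ k ]) ℤ.* + 1) ℤ.* + b) ℤ.* + 1
      ℤ-≤.≡⟨ expand (+ suc q) (+ suc k) (+ b) ⟩
    + 2 ℤ.* + suc q ℤ.* + b ℤ.- + suc k ℤ.* + b
      ℤ-≤.≡⟨ cong (ℤ._- + suc k ℤ.* + b) (trans (cong (ℤ._* + b) (sym (ℤ.pos-* 2 (suc q)))) (sym (ℤ.pos-* (2 · suc q) b))) ⟩
    + (2 · suc q · b) ℤ.- + suc k ℤ.* + b
      ℤ-≤.≤⟨ ℤ.+-monoˡ-≤ (ℤ.- (+ suc k ℤ.* + b)) (ℤ.+≤+ natural) ⟩
    + (suc q · a + suc k · b) ℤ.- + suc k ℤ.* + b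
      ℤ-≤.≡⟨ cong (ℤ._- + suc k ℤ.* + b) (products (suc q) a (suc k)) ⟩
    + suc q ℤ.* + a ℤ.+ + suc k ℤ.* + b ℤ.- + suc k ℤ.* + b
      ℤ-≤.≡⟨ cancel (+ suc q) (+ a) (+ suc k ℤ.* + b) ⟩
    + a ℤ.* (+ 1 ℤ.* + suc q ℤ.* + 1)
      ℤ-≤.≡⟨ cong (+ a ℤ.*_) (sym (trans (ℤ.pos-* (1 · suc q) 1) (cong (ℤ._* + 1) (ℤ.pos-* 1 (suc q))))) ⟩
    + a ℤ.* + (1 · suc q · 1) ℤ-≤.∎
    where
    module ℤ-≤ = ℤ.≤-Reasoning
    expand : ∀ q k b → ((+ 2 ℤ.* q ℤ.+ (ℤ.- k) ℤ.* + 1) ℤ.* b) ℤ.* + 1 ≡ + 2 ℤ.* q ℤ.* b ℤ.- k ℤ.* b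
    expand = ℤ-Solver.solve-∀
    cancel : ∀ q a c → q ℤ.* a ℤ.+ c ℤ.- c ≡ a ℤ.* (+ 1 ℤ.* q ℤ.* + 1)
    cancel = ℤ-Solver.solve-∀
ratioℚ (mkℚ (+ 0) _ _) (ℚ.*<* (ℤ.+<+ ()))
ratioℚ (mkℚ (ℤ.-[1+ _ ]) _ _) (ℚ.*<* ())

theorem3 : (ε : ℚ) → ε > 0ℚ →
    ∃[ n₀ ] ((n : ℕ) → n₀ ≤ n →
    (T₀ : KeyTree n) → IsBST T₀ →
    Σ[ X ∈ List (Fin n) ] Σ[ X′ ∈ List (Fin n) ]
    (X ≢ []) × (X′ ⊆ X) ×
    (+ cost GF X′ T₀ / 1 ≥ (+ 2 / 1 - ε) * (+ cost GF X T₀ / 1)))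
-- The gadget takes 4·2^height - 3 keys and so fits into every tree with at least that many.
theorem3 ε ε>0 = gadgetSize height , λ n n₀≤n T₀ bst →
  let g , rest , split , _ = cutGadget height 0 (inorder T₀)
        (ℕ.≤-trans (ℕ.≤-reflexive (ℕ.+-identityʳ (gadgetSize height))) (ℕ.≤-trans n₀≤n (n≤length bst)))
      S = shallow g (leaf tt) (spine rest)
      D = deep g (leaf tt) (spine rest)
      order = trans split (cong (gadgetKeys g ++_) (sym (inorder-spine rest)))
      orderS = trans order (sym (inorder-shallow g (leaf tt) (spine rest)))
      orderD = trans order (sym (inorder-deep g (leaf tt) (spine rest)))
      asc = searchTree⇒ascending (IsBST.searchTree bst) (everything T₀)
      ascS = subst (Ascending nothing nothing) orderS asc
      ascD = subst (Ascending nothing nothing) orderD asc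
      -- A bound for the cost of both tours, at `n` per query. It is independent of the number `N`
      -- of rounds, which can thus be chosen in terms of it.
      K = length (tour D) · n + length (tour S) · n
      N = suc (2 · K)
      rounds = queries N g
      -- The future is left open, because `tour S ++ rounds` follows in `X` and `rounds` alone in
      -- `X′`.
      toD : ∀ Y → Serves Y nothing nothing 0 T₀ (tour D) D
      toD Y = tour-forces D T₀ (tour D) ascD orderD (restrict-everything (tour D))
      toS : Serves rounds nothing nothing 0 D (tour S) S
      toS = tour-forces S D (tour S) ascS (trans (sym orderD) orderS) (restrict-everything (tour S))
      upper = begin
        cost GF (tour D ++ tour S ++ rounds) T₀
          ≤⟨ cost-serves-≤ (toD (tour S ++ rounds)) ⟩
        length (tour D) · n + cost GF (tour S ++ rounds) D
          ≤⟨ ℕ.+-monoʳ-≤ (length (tour D) · n) (cost-serves-≤ toS) ⟩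
        length (tour D) · n + (length (tour S) · n + cost GF rounds S)
          ≡⟨ ℕ.+-assoc (length (tour D) · n) (length (tour S) · n) _ ⟨
        K + cost GF rounds S
          ≤⟨ ℕ.+-monoʳ-≤ K (cost-calm-≤ S rounds ascS (shallow-calm N g (leaf tt) (spine rest) ascS)) ⟩
        K + totalLength S rounds ∎
      -- The tour to `D` only adds to the cost of `X′`, so its share is dropped.
      lower = ℕ.≤-trans (cost-calm-≥ D rounds ascD (deep-calm N g (leaf tt) (spine rest) ascD))
                        (cost-serves-≥ (toD rounds))
  in tour D ++ tour S ++ rounds , tour D ++ rounds , tour-deep≢[] g , ++⁺ (⊆-refl {x = tour D}) (++⁺ˡ (tour S) ⊆-refl) ,
     ratioℚ ε ε>0 (ratio q K (totalLength-shallow N g (leaf tt) (spine rest) ascS)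
                             (totalLength-deep N g (leaf tt) (spine rest) ascD) upper lower)
  where
  open ℕ.≤-Reasoning
  q = ℚ.ℚ.denominator-1 ε
  height = 2 · suc q
  tour-deep≢[] : ∀ {n h A H Q} (g : Gadget n h) → tour (deep g A H) ++ Q ≢ []
  tour-deep≢[] (leaf _) ()
  tour-deep≢[] (node _ _ _ _ _) ()
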